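{- Let $G$ be a finite graph without isolated vertices, and let $\ell \le q$ be nonnegative integers. Let $d_v$ be the degree of vertex $v$ in $G$. Then \[ \hom(G, K_q^{\ell \circ}) \le \prod_{uv \in E(G)} \hom(K_{d_u,d_v}, K_q^{\ell \circ})^{1/(d_u d_v)}. \]
   Context: Graphs $G$ are finite and simple. $K_q^{\ell\circ}$ denotes the complete graph on $q$ vertices in which exactly $\ell$ of the vertices additionally carry a loop. For graphs $G,H$ (where $H$ may have loops), $\hom(G,H)$ is the number of graph homomorphisms from $G$ to $H$, i.e., maps $\phi\colon V(G)\to V(H)$ such that $\phi(u)\phi(v)\in E(H)$ whenever $uv\in E(G)$ (a looped vertex $x$ of $H$ means $xx\in E(H)$). Equivalently, $\hom(G,K_q^{\ell\circ})$ counts semiproper colorings: assignments of colors from a set of $q$ colors, $\ell$ of which are "looped", such that for each non-looped color the set of vertices receiving it is independent. $K_{a,b}$ is the complete bipartite graph with parts of sizes $a,b$. -}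

module Defs where

open import Data.Bool using (Bool; true; false; not; _∧_; _∨_; _xor_; if_then_else_)
open import Data.Nat using (ℕ; zero; suc; _+_; _*_; _^_; _≤_; _<ᵇ_)
open import Data.Fin using (Fin; toℕ)
import Data.Fin as F
open import Data.Fin.Properties using (_≟_)
open import Data.List using (List; []; _∷_; length; map; concatMap; filter; lookup; allFin; foldr)
open import Data.Product using (_×_; _,_; proj₁; proj₂)
open import Data.Vec.Functional using () renaming (_∷_ to _∷ᶠ_)
open import Relation.Nullary.Decidable using (isYes; ⌊_⌋)
open import Relation.Binary.PropositionalEquality using (_≡_; refl)

record SimpleGraph : Set where
  field
    n      : ℕ
    adj    : Fin n → Fin n → Bool
    sym    : ∀ u v → adj u v ≡ adj v u
    irrefl : ∀ v → adj v v ≡ false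
open SimpleGraph public

sumF : (k : ℕ) → (Fin k → ℕ) → ℕ
sumF zero    f = 0
sumF (suc k) f = f F.zero + sumF k (λ i → f (F.suc i))

prodF : (k : ℕ) → (Fin k → ℕ) → ℕ
prodF zero    f = 1
prodF (suc k) f = f F.zero * prodF k (λ i → f (F.suc i))

degree : (G : SimpleGraph) → Fin (n G) → ℕ
degree G v = sumF (n G) (λ w → if adj G v w then 1 else 0)

NoIsolated : SimpleGraph → Set
NoIsolated G = ∀ v → 1 ≤ degree G v

edges : (G : SimpleGraph) → List (Fin (n G) × Fin (n G))
edges G = filter (λ p → ((toℕ (proj₁ p) <ᵇ toℕ (proj₂ p)) ∧ adj G (proj₁ p) (proj₂ p)) Data.Bool.≟ true)
                 (concatMap (λ u → map (λ v → (u , v)) (allFin (n G))) (allFin (n G)))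
  where import Data.Bool

-- Homomorphisms into K_q^{ℓ∘}: vertex set Fin q, every two distinct
-- vertices adjacent, and vertex c carries a loop iff toℕ c < ℓ
-- (so exactly ℓ looped vertices when ℓ ≤ q).

KEdge : (q ℓ : ℕ) → Fin q → Fin q → Bool
KEdge q ℓ x y = not ⌊ x ≟ y ⌋ ∨ (toℕ x <ᵇ ℓ)

allB : {k : ℕ} → (Fin k → Bool) → Bool
allB {k} p = foldr _∧_ true (map p (allFin k))

IsHomB : (G : SimpleGraph) (q ℓ : ℕ) → (Fin (n G) → Fin q) → Bool
IsHomB G q ℓ φ = allB (λ u → allB (λ v → not (adj G u v) ∨ KEdge q ℓ (φ u) (φ v)))

allMaps : (m q : ℕ) → List (Fin m → Fin q)
allMaps zero    q = (λ ()) ∷ []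
allMaps (suc m) q = concatMap (λ c → map (λ f → c ∷ᶠ f) (allMaps m q)) (allFin q)

homK : (G : SimpleGraph) (q ℓ : ℕ) → ℕ
homK G q ℓ = length (filter (λ φ → IsHomB G q ℓ φ Data.Bool.≟ true) (allMaps (n G) q))
  where import Data.Bool

private
  xor-comm : ∀ x y → x xor y ≡ y xor x
  xor-comm false false = refl
  xor-comm false true  = refl
  xor-comm true  false = refl
  xor-comm true  true  = refl
  xor-self : ∀ x → x xor x ≡ false
  xor-self false = refl
  xor-self true  = refl

Kbip : ℕ → ℕ → SimpleGraph
Kbip a b = record
  { n = a + b
  ; adj = λ i j → (toℕ i <ᵇ a) xor (toℕ j <ᵇ a)
  ; sym = λ i j → xor-comm (toℕ i <ᵇ a) (toℕ j <ᵇ a)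
  ; irrefl = λ i → xor-self (toℕ i <ᵇ a)
  }

-- The right-hand side, cleared of fractional exponents.
-- Index the edges e = 0..E-1, with weight m_e = d_u d_v and base
-- a_e = hom(K_{d_u,d_v}, K_q^{ℓ∘}).  With N = ∏_e m_e and
-- N/m_e = ∏_{f ≠ e} m_f, the inequality  x ≤ ∏_e a_e^{1/m_e}
-- is equivalent to  x^N ≤ ∏_e a_e^{N/m_e}.

numEdges : SimpleGraph → ℕ
numEdges G = length (edges G)

edgeAt : (G : SimpleGraph) → Fin (numEdges G) → Fin (n G) × Fin (n G)
edgeAt G e = lookup (edges G) e

edgeWeight : (G : SimpleGraph) → Fin (numEdges G) → ℕ
edgeWeight G e = degree G (proj₁ (edgeAt G e)) * degree G (proj₂ (edgeAt G e))

edgeBase : (G : SimpleGraph) (q ℓ : ℕ) → Fin (numEdges G) → ℕ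
edgeBase G q ℓ e =
  homK (Kbip (degree G (proj₁ (edgeAt G e))) (degree G (proj₂ (edgeAt G e)))) q ℓ

commonExp : SimpleGraph → ℕ
commonExp G = prodF (numEdges G) (edgeWeight G)

exponentAt : (G : SimpleGraph) → Fin (numEdges G) → ℕ
exponentAt G e = prodF (numEdges G) (λ f → if ⌊ f ≟ e ⌋ then 1 else edgeWeight G f)

module Submission where

-- Delete a vertex w of maximum degree Δ.  Fixing its colour z turns a neighbour's list L into L ∖ {z}
-- (unless z is looped), so the claim is proved for arbitrary colour weights at the vertices, by induction.
-- Normalise t_{a,b}(A,B) = (hom(K_{a,b}; A,B) / (|A|^b |B|^a))^{1/ab}.  If u, v ∈ N(w) are adjacent then
--   t_{a-1,b-1}(A∖z, B∖z) ≤ t_{a-1,b}(A∖z, B),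
-- because z is compatible with every colour of A∖z and norms increase with b.  Hence each edge of G - w
-- sees the deletion of z at one end only, as in a triangle-free graph.  Hölder's inequality over z,
-- with exponent Δ for each neighbour u of w and Δ(d_u - 1) for each further edge at u, then splits the
-- sum into terms bounded by two more applications of Hölder.  All counts stay in ℕ with cleared
-- exponents; Δ-th roots enter only as limits of integer roots.

open import Defs hiding (sym; n; irrefl)
open import Data.Bool using (Bool; true; false; if_then_else_; not; _∧_; _∨_)
import Data.Bool as Bool
open import Data.Empty using (⊥-elim)
open import Data.Fin using (Fin; zero; suc; toℕ; _↑ˡ_; _↑ʳ_)
open import Data.Fin.Properties using (_≟_; toℕ-injective)
open import Data.List using (List; []; _∷_; _++_; map; length; replicate; concatMap; allFin; tabulate; filter; foldr; lookup)
open import Data.List.Properties using (length-++; length-replicate)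
open import Data.Nat using (ℕ; zero; suc; _+_; _*_; _^_; _∸_; _≤_; _<_; _<ᵇ_; z≤n; s≤s; >-nonZero; _≤?_; _<?_)
import Data.Nat as ℕ
open import Data.Nat.Properties hiding (_≟_)
open import Data.Nat.Tactic.RingSolver using (solve-∀)
open import Data.Product using (∃; ∃₂; _×_; _,_; proj₁; proj₂)
open import Data.Sum using (_⊎_; inj₁; inj₂)
open import Data.Vec.Functional using () renaming (_∷_ to _∷ᶠ_)
open import Relation.Binary.PropositionalEquality using (_≡_; _≢_; refl; sym; trans; cong; cong₂; subst; module ≡-Reasoning)
open import Relation.Nullary using (yes; no; Dec)
open import Relation.Nullary.Decidable using (⌊_⌋)

-- Superadditivity of the geometric mean

-- The accounting makes the deleted edges pay for everything. A remaining edge at a neighbour u of w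
-- costs the count for uw to the power 1/((d_u - 1) d_u Δ); over the d_u - 1 such edges this adds up
-- to 1/(d_u Δ), the exponent of the edge uw itself. Maximality of Δ enters because the estimate
-- enlarges a K_{a,b} to a K_{a,Δ}, which needs `b ≤ Δ`. The obstacle is an edge inside N(w): once
-- it is reduced to a deletion at one end, a power of the restricted mass at the other end is left
-- over. Its sum over z obeys the same estimate, with a constant in place of the neighbourhood
-- weight, at the same exponent and the same price as an ordinary edge. Hence triangles need no
-- budget of their own. The Hölder exponents vary with the degrees, and the ideal factors are not
-- integers. Each factor is therefore tested against one integer function `μ`, which stands for D
-- times the Δ-th root of the count that remains once w has colour z. Certificates of this kind
-- multiply, and only the total exponent of `μ` has to come out right.

*-^-distrib : ∀ x y k → (x * y) ^ k ≡ x ^ k * y ^ k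
*-^-distrib x y zero    = refl
*-^-distrib x y (suc k) rewrite *-^-distrib x y k = shuffle x y (x ^ k) (y ^ k)
  where
  shuffle : ∀ a b c d → a * b * (c * d) ≡ a * c * (b * d)
  shuffle = solve-∀

^-cancelˡ-≤ : ∀ {x y} k → 0 < k → x ^ k ≤ y ^ k → x ≤ y
^-cancelˡ-≤ {x} {y} k k>0 xk≤yk with x ≤? y
... | yes x≤y = x≤y
... | no  x≰y = ⊥-elim (<⇒≱ (^-monoˡ-< k {{>-nonZero k>0}} (≰⇒> x≰y)) xk≤yk)

*-cancelˡ-≤′ : ∀ {x y} c → 0 < c → c * x ≤ c * y → x ≤ y
*-cancelˡ-≤′ c c>0 = *-cancelˡ-≤ c {{>-nonZero c>0}}

^-positive : ∀ {x} k → 0 < x → 0 < x ^ k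
^-positive {x} k x>0 = m^n>0 x {{>-nonZero x>0}} k

n^n>0 : ∀ n → 0 < n ^ n
n^n>0 zero    = s≤s z≤n
n^n>0 (suc n) = m^n>0 (suc n) (suc n)

zero-or-positive : ∀ x → (x ≡ 0 → ∀ {ℓ} {A : Set ℓ} → A) → 0 < x
zero-or-positive zero    f = f refl
zero-or-positive (suc x) f = s≤s z≤n

2uv≤u²+v² : ∀ u v → 2 * (u * v) ≤ u * u + v * v
2uv≤u²+v² u v with ≤-total u v
... | inj₁ u≤v = subst (λ t → 2 * (u * t) ≤ u * u + t * t) (m+[n∸m]≡n u≤v)
                   (subst (2 * (u * (u + (v ∸ u))) ≤_) (expand u (v ∸ u)) (m≤m+n _ _))
  where
  expand : ∀ u d → 2 * (u * (u + d)) + d * d ≡ u * u + (u + d) * (u + d)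
  expand = solve-∀
... | inj₂ v≤u = subst (λ t → 2 * (t * v) ≤ t * t + v * v) (m+[n∸m]≡n v≤u)
                   (subst (2 * ((v + (u ∸ v)) * v) ≤_) (expand v (u ∸ v)) (m≤m+n _ _))
  where
  expand : ∀ v d → 2 * ((v + d) * v) + d * d ≡ (v + d) * (v + d) + v * v
  expand = solve-∀

-- AM-GM for `n` copies of `u ^ suc n` and one of `v ^ suc n`. The induction multiplies the previous
-- case by `v`; adding `n * (u * p * v)` to both sides avoids a subtraction and makes room for
-- `2uv≤u²+v²`.
bernoulli : ∀ u v n → suc n * (u ^ n * v) ≤ v ^ suc n + n * u ^ suc n
bernoulli u v zero    = ≤-reflexive (base v)
  where
  base : ∀ v → 1 * (1 * v) ≡ v * 1 + 0
  base = solve-∀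
bernoulli u v (suc n) = +-cancelʳ-≤ (n * (u * p * v)) _ _ (begin
  suc (suc n) * (u * p * v) + n * (u * p * v)      ≡⟨ e₁ u v n p ⟩
  suc n * p * (2 * (u * v))                        ≤⟨ *-monoʳ-≤ (suc n * p) (2uv≤u²+v² u v) ⟩
  suc n * p * (u * u + v * v)                      ≡⟨ e₂ u v n p ⟩
  suc n * (u * (u * p)) + v * (suc n * (p * v))    ≤⟨ +-monoʳ-≤ (suc n * (u * (u * p))) (*-monoʳ-≤ v (bernoulli u v n)) ⟩
  suc n * (u * (u * p)) + v * (v * s + n * (u * p)) ≡⟨ e₃ u v n p s ⟩
  v * (v * s) + suc n * (u * (u * p)) + n * (u * p * v) ∎)
  where
  open ≤-Reasoning
  p = u ^ n
  s = v ^ n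
  e₁ : ∀ u v n p → suc (suc n) * (u * p * v) + n * (u * p * v) ≡ suc n * p * (2 * (u * v))
  e₁ = solve-∀
  e₂ : ∀ u v n p → suc n * p * (u * u + v * v) ≡ suc n * (u * (u * p)) + v * (suc n * (p * v))
  e₂ = solve-∀
  e₃ : ∀ u v n p s → suc n * (u * (u * p)) + v * (v * s + n * (u * p))
                   ≡ v * (v * s) + suc n * (u * (u * p)) + n * (u * p * v)
  e₃ = solve-∀

-- For a fixed sum `s + t` the product `s ^ N * t` is largest at `s = N * t`. This is also where
-- `bernoulli` is sharp for `u = suc N * s` and `v = N * (s + t)`.
amgm-step : ∀ N s t → suc N ^ suc N * (s ^ N * t) ≤ N ^ N * (s + t) ^ suc N
amgm-step zero      s t = subst₂′ (m≤n+m t s)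
  where
  e₁ : ∀ t → t ≡ 1 * 1 * (1 * t)
  e₁ = solve-∀
  e₂ : ∀ s t → s + t ≡ 1 * ((s + t) * 1)
  e₂ = solve-∀
  subst₂′ : t ≤ s + t → 1 * 1 * (1 * t) ≤ 1 * ((s + t) * 1)
  subst₂′ h = ≤-trans (≤-reflexive (sym (e₁ t))) (≤-trans h (≤-reflexive (e₂ s t)))
amgm-step N@(suc _) s t = *-cancelˡ-≤ N (+-cancelʳ-≤ (N * (suc N ^ suc N * s ^ suc N)) _ _ (begin
  N * (suc N ^ suc N * (s ^ N * t)) + N * (suc N ^ suc N * s ^ suc N)
    ≡⟨ e₁ N s t (suc N ^ N) (s ^ N) ⟩
  suc N * (suc N ^ N * s ^ N * (N * (s + t)))
    ≡⟨ cong (λ x → suc N * (x * (N * (s + t)))) (*-^-distrib (suc N) s N) ⟨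
  suc N * ((suc N * s) ^ N * (N * (s + t)))
    ≤⟨ bernoulli (suc N * s) (N * (s + t)) N ⟩
  (N * (s + t)) ^ suc N + N * (suc N * s) ^ suc N
    ≡⟨ cong₂ (λ x y → x + N * y) (*-^-distrib N (s + t) (suc N)) (*-^-distrib (suc N) s (suc N)) ⟩
  N * N ^ N * (s + t) ^ suc N + N * (suc N ^ suc N * s ^ suc N)
    ≡⟨ cong (_+ N * (suc N ^ suc N * s ^ suc N)) (*-assoc N (N ^ N) _) ⟩
  N * (N ^ N * (s + t) ^ suc N) + N * (suc N ^ suc N * s ^ suc N) ∎))
  where
  open ≤-Reasoning
  e₁ : ∀ N s t a b → N * (suc N * a * (b * t)) + N * (suc N * a * (s * b)) ≡ suc N * (a * b * (N * (s + t)))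
  e₁ = solve-∀

fsts snds tots : List (ℕ × ℕ) → ℕ
fsts []             = 1
fsts ((a , _) ∷ ps) = a * fsts ps
snds []             = 1
snds ((_ , b) ∷ ps) = b * snds ps
tots []             = 1
tots ((a , b) ∷ ps) = (a + b) * tots ps

-- Σₖ aₖ/(aₖ + bₖ) with the denominators cleared, and likewise for bₖ.
fstShare sndShare : List (ℕ × ℕ) → ℕ
fstShare []             = 0
fstShare ((a , b) ∷ ps) = a * tots ps + (a + b) * fstShare ps
sndShare []             = 0
sndShare ((a , b) ∷ ps) = b * tots ps + (a + b) * sndShare ps

share-sum : ∀ ps → fstShare ps + sndShare ps ≡ length ps * tots ps
share-sum []             = refl
share-sum ((a , b) ∷ ps) = begin
  a * T + (a + b) * U + (b * T + (a + b) * V) ≡⟨ e₁ a b T U V ⟩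
  (a + b) * T + (a + b) * (U + V)             ≡⟨ cong (λ x → (a + b) * T + (a + b) * x) (share-sum ps) ⟩
  (a + b) * T + (a + b) * (length ps * T)     ≡⟨ e₂ (a + b) T (length ps) ⟩
  (a + b) * T + length ps * ((a + b) * T)     ∎
  where
  open ≡-Reasoning
  T = tots ps
  U = fstShare ps
  V = sndShare ps
  e₁ : ∀ a b T U V → a * T + (a + b) * U + (b * T + (a + b) * V) ≡ (a + b) * T + (a + b) * (U + V)
  e₁ = solve-∀
  e₂ : ∀ c T n → c * T + c * (n * T) ≡ c * T + n * (c * T)
  e₂ = solve-∀

-- Here `A / T` is the product and `U / T` the sum of the `N` fractions so far, and `a / c` is the
-- new one. `amgm-step` is applied to `c * U` and `a * T`, the two sums over the common denominator
-- `c * T`.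
amgm-inductive : ∀ N a c A T U → N ^ N * (A * T ^ N) ≤ U ^ N * T →
  suc N ^ suc N * (a * A * (c * T) ^ suc N) ≤ (a * T + c * U) ^ suc N * (c * T)
amgm-inductive N a c A T U ih = *-cancelˡ-≤′ (N ^ N) (n^n>0 N) (begin
  N ^ N * (suc N ^ suc N * (a * A * (c * T) ^ suc N))
    ≡⟨ cong (λ x → N ^ N * (suc N ^ suc N * (a * A * (c * T * x)))) (*-^-distrib c T N) ⟩
  N ^ N * (suc N ^ suc N * (a * A * (c * T * (c ^ N * T ^ N))))
    ≡⟨ e₁ (N ^ N) (suc N ^ suc N) a A c T (c ^ N) (T ^ N) ⟩
  suc N ^ suc N * (a * (c * T) * c ^ N) * (N ^ N * (A * T ^ N))
    ≤⟨ *-monoʳ-≤ (suc N ^ suc N * (a * (c * T) * c ^ N)) ih ⟩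
  suc N ^ suc N * (a * (c * T) * c ^ N) * (U ^ N * T)
    ≡⟨ e₂ (suc N ^ suc N) a c T (c ^ N) (U ^ N) ⟩
  suc N ^ suc N * (c ^ N * U ^ N * (a * T)) * (c * T)
    ≡⟨ cong (λ x → suc N ^ suc N * (x * (a * T)) * (c * T)) (*-^-distrib c U N) ⟨
  suc N ^ suc N * ((c * U) ^ N * (a * T)) * (c * T)
    ≤⟨ *-monoˡ-≤ (c * T) (amgm-step N (c * U) (a * T)) ⟩
  N ^ N * (c * U + a * T) ^ suc N * (c * T)
    ≡⟨ cong (λ x → N ^ N * x ^ suc N * (c * T)) (+-comm (c * U) (a * T)) ⟩
  N ^ N * (a * T + c * U) ^ suc N * (c * T)
    ≡⟨ *-assoc (N ^ N) _ (c * T) ⟩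
  N ^ N * ((a * T + c * U) ^ suc N * (c * T)) ∎)
  where
  open ≤-Reasoning
  e₁ : ∀ n m a A c T x y → n * (m * (a * A * (c * T * (x * y)))) ≡ m * (a * (c * T) * x) * (n * (A * y))
  e₁ = solve-∀
  e₂ : ∀ m a c T x u → m * (a * (c * T) * x) * (u * T) ≡ m * (x * u * (a * T)) * (c * T)
  e₂ = solve-∀

-- AM-GM for the fractions a/(a + b): their product is `fsts ps / tots ps`, their sum
-- `fstShare ps / tots ps`.
amgm-fst : ∀ ps → length ps ^ length ps * (fsts ps * tots ps ^ length ps)
                  ≤ fstShare ps ^ length ps * tots ps
amgm-fst []             = ≤-refl
amgm-fst ((a , b) ∷ ps) =
  amgm-inductive (length ps) a (a + b) (fsts ps) (tots ps) (fstShare ps) (amgm-fst ps)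

amgm-snd : ∀ ps → length ps ^ length ps * (snds ps * tots ps ^ length ps)
                  ≤ sndShare ps ^ length ps * tots ps
amgm-snd []             = ≤-refl
amgm-snd ((a , b) ∷ ps) =
  amgm-inductive (length ps) b (a + b) (snds ps) (tots ps) (sndShare ps) (amgm-snd ps)

fsts≤tots : ∀ ps → fsts ps ≤ tots ps
fsts≤tots []             = ≤-refl
fsts≤tots ((a , b) ∷ ps) = *-mono-≤ (m≤m+n a b) (fsts≤tots ps)

snds≤tots : ∀ ps → snds ps ≤ tots ps
snds≤tots []             = ≤-refl
snds≤tots ((a , b) ∷ ps) = *-mono-≤ (m≤n+m b a) (snds≤tots ps)

-- By AM-GM the average fraction `U / (N * T)` is at least the N-th root of `A / T`, hence at least
-- that of `x ^ N / T`; the latter exceeds `x / z` strictly because `T < z ^ N`.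
share-bound : ∀ N x z A T U → 0 < N → 0 < x → 0 < T → T < z ^ N → x ^ N ≤ A →
  N ^ N * (A * T ^ N) ≤ U ^ N * T → N * x * T < U * z
share-bound N x z A T U N>0 x>0 T>0 T<zN xN≤A h with N * x * T <? U * z
... | yes p = p
... | no ¬p = ⊥-elim (<⇒≱ gap (^-monoˡ-≤ N (≮⇒≥ ¬p)))
  where
  open ≤-Reasoning
  lower : (N * x * T) ^ N ≤ U ^ N * T
  lower = begin
    (N * x * T) ^ N           ≡⟨ *-^-distrib (N * x) T N ⟩
    (N * x) ^ N * T ^ N       ≡⟨ cong (_* T ^ N) (*-^-distrib N x N) ⟩
    N ^ N * x ^ N * T ^ N     ≡⟨ *-assoc (N ^ N) _ _ ⟩
    N ^ N * (x ^ N * T ^ N)   ≤⟨ *-monoʳ-≤ (N ^ N) (*-monoˡ-≤ (T ^ N) xN≤A) ⟩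
    N ^ N * (A * T ^ N)       ≤⟨ h ⟩
    U ^ N * T                 ∎
  UN>0 : 0 < U ^ N
  UN>0 = zero-or-positive (U ^ N) λ eq → ⊥-elim (<⇒≱
    (^-positive N (*-mono-≤ (*-mono-≤ N>0 x>0) T>0))
    (subst (λ t → (N * x * T) ^ N ≤ t * T) eq lower))
  gap : (N * x * T) ^ N < (U * z) ^ N
  gap = begin-strict
    (N * x * T) ^ N   ≤⟨ lower ⟩
    U ^ N * T         <⟨ *-monoʳ-< (U ^ N) {{>-nonZero UN>0}} T<zN ⟩
    U ^ N * z ^ N     ≡⟨ *-^-distrib U z N ⟨
    (U * z) ^ N       ∎

-- If the conclusion failed, `share-bound` with `z = x + y` would apply to both components. The
-- shares add up to `N * T` by `share-sum`, so the two strict bounds would sum to a number being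
-- less than itself.
geometric-mean-superadditive : ∀ x y ps → x ^ length ps ≤ fsts ps → y ^ length ps ≤ snds ps →
  (x + y) ^ length ps ≤ tots ps
geometric-mean-superadditive x y [] hx hy = ≤-refl
geometric-mean-superadditive x y ps@(_ ∷ ps′) hx hy with (x + y) ^ length ps ≤? tots ps
... | yes p = p
... | no ¬p = go x y refl refl
  where
  N = length ps
  T = tots ps
  U = fstShare ps
  V = sndShare ps
  N>0 : 0 < N
  N>0 = s≤s z≤n
  T<zN : T < (x + y) ^ N
  T<zN = ≰⇒> ¬p
  e₁ : ∀ n x y t → n * x * t + n * y * t ≡ n * t * (x + y)
  e₁ = solve-∀
  T>0ˣ : 0 < x → 0 < T
  T>0ˣ x>0 = ≤-trans (^-positive N x>0) (≤-trans hx (fsts≤tots ps))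
  T>0ʸ : 0 < y → 0 < T
  T>0ʸ y>0 = ≤-trans (^-positive N y>0) (≤-trans hy (snds≤tots ps))
  contra : N * x * T + N * y * T < U * (x + y) + V * (x + y) → (x + y) ^ N ≤ T
  contra h = ⊥-elim (<-irrefl
    (trans (e₁ N x y T) (trans (cong (_* (x + y)) (sym (share-sum ps))) (*-distribʳ-+ (x + y) U V))) h)
  -- `share-bound` says nothing about a zero summand, but such a summand adds nothing on the left,
  -- and one strict inequality suffices.
  go : ∀ x′ y′ → x′ ≡ x → y′ ≡ y → (x + y) ^ N ≤ T
  go zero zero refl refl = z≤n
  go (suc _) zero refl refl = contra (+-mono-<-≤
    (share-bound N x (x + y) _ T U N>0 (s≤s z≤n) (T>0ˣ (s≤s z≤n)) T<zN hx (amgm-fst ps))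
    (≤-trans (≤-reflexive (cong (_* T) (*-zeroʳ N))) z≤n))
  go zero (suc _) refl refl = contra (+-mono-≤-<
    (≤-trans (≤-reflexive (cong (_* T) (*-zeroʳ N))) z≤n)
    (share-bound N y (x + y) _ T V N>0 (s≤s z≤n) (T>0ʸ (s≤s z≤n)) T<zN hy (amgm-snd ps)))
  go (suc _) (suc _) refl refl = contra (+-mono-<
    (share-bound N x (x + y) _ T U N>0 (s≤s z≤n) (T>0ˣ (s≤s z≤n)) T<zN hx (amgm-fst ps))
    (share-bound N y (x + y) _ T V N>0 (s≤s z≤n) (T>0ʸ (s≤s z≤n)) T<zN hy (amgm-snd ps)))

-- Sums and Hölder's inequality

∑ : {Z : Set} → List Z → (Z → ℕ) → ℕ
∑ []       f = 0
∑ (z ∷ zs) f = f z + ∑ zs f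

module _ {Z : Set} where

  ∑-cong : ∀ (zs : List Z) {f g} → (∀ z → f z ≡ g z) → ∑ zs f ≡ ∑ zs g
  ∑-cong []       f≗g = refl
  ∑-cong (z ∷ zs) f≗g = cong₂ _+_ (f≗g z) (∑-cong zs f≗g)

  ∑-mono : ∀ (zs : List Z) {f g} → (∀ z → f z ≤ g z) → ∑ zs f ≤ ∑ zs g
  ∑-mono []       f≤g = z≤n
  ∑-mono (z ∷ zs) f≤g = +-mono-≤ (f≤g z) (∑-mono zs f≤g)

  ∑-zero : ∀ (zs : List Z) → ∑ zs (λ _ → 0) ≡ 0
  ∑-zero []       = refl
  ∑-zero (z ∷ zs) = ∑-zero zs

  ∑-+ : ∀ (zs : List Z) f g → ∑ zs (λ z → f z + g z) ≡ ∑ zs f + ∑ zs g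
  ∑-+ []       f g = refl
  ∑-+ (z ∷ zs) f g = trans (cong (f z + g z +_) (∑-+ zs f g)) (e (f z) (g z) _ _)
    where
    e : ∀ a b c d → a + b + (c + d) ≡ a + c + (b + d)
    e = solve-∀

  ∑-*ˡ : ∀ (zs : List Z) c f → ∑ zs (λ z → c * f z) ≡ c * ∑ zs f
  ∑-*ˡ []       c f = sym (*-zeroʳ c)
  ∑-*ˡ (z ∷ zs) c f = trans (cong (c * f z +_) (∑-*ˡ zs c f)) (sym (*-distribˡ-+ c _ _))

  ∑-*ʳ : ∀ (zs : List Z) c f → ∑ zs (λ z → f z * c) ≡ ∑ zs f * c
  ∑-*ʳ zs c f = trans (∑-cong zs (λ z → *-comm (f z) c)) (trans (∑-*ˡ zs c f) (*-comm c _))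

  ∑-++ : ∀ (zs zs′ : List Z) f → ∑ (zs ++ zs′) f ≡ ∑ zs f + ∑ zs′ f
  ∑-++ []       zs′ f = refl
  ∑-++ (z ∷ zs) zs′ f = trans (cong (f z +_) (∑-++ zs zs′ f)) (sym (+-assoc (f z) _ _))

∑-map : ∀ {Y Z : Set} (g : Y → Z) (ys : List Y) f → ∑ (map g ys) f ≡ ∑ ys (λ y → f (g y))
∑-map g []       f = refl
∑-map g (y ∷ ys) f = cong (f (g y) +_) (∑-map g ys f)

∑-concatMap : ∀ {Y Z : Set} (g : Y → List Z) (ys : List Y) f → ∑ (concatMap g ys) f ≡ ∑ ys (λ y → ∑ (g y) f)
∑-concatMap g []       f = refl
∑-concatMap g (y ∷ ys) f = trans (∑-++ (g y) _ f) (cong (∑ (g y) f +_) (∑-concatMap g ys f))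

∑-swap : ∀ {Y Z : Set} (ys : List Y) (zs : List Z) (f : Y → Z → ℕ) →
  ∑ ys (λ y → ∑ zs (f y)) ≡ ∑ zs (λ z → ∑ ys (λ y → f y z))
∑-swap []       zs f = sym (∑-zero zs)
∑-swap (y ∷ ys) zs f = trans (cong (∑ zs (f y) +_) (∑-swap ys zs f))
                             (sym (∑-+ zs (f y) (λ z → ∑ ys (λ y → f y z))))

module _ {Z : Set} where

  prodAt : List (Z → ℕ) → Z → ℕ
  prodAt []       z = 1
  prodAt (f ∷ fs) z = f z * prodAt fs z

  prodSum : List Z → List (Z → ℕ) → ℕ
  prodSum zs []       = 1
  prodSum zs (f ∷ fs) = ∑ zs f * prodSum zs fs

  prodAt-++ : ∀ fs gs z → prodAt (fs ++ gs) z ≡ prodAt fs z * prodAt gs z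
  prodAt-++ []       gs z = sym (+-identityʳ _)
  prodAt-++ (f ∷ fs) gs z = trans (cong (f z *_) (prodAt-++ fs gs z)) (sym (*-assoc (f z) _ _))

  prodSum-++ : ∀ zs fs gs → prodSum zs (fs ++ gs) ≡ prodSum zs fs * prodSum zs gs
  prodSum-++ zs []       gs = sym (+-identityʳ _)
  prodSum-++ zs (f ∷ fs) gs = trans (cong (∑ zs f *_) (prodSum-++ zs fs gs)) (sym (*-assoc (∑ zs f) _ _))

  prodAt-replicate : ∀ n f z → prodAt (replicate n f) z ≡ f z ^ n
  prodAt-replicate zero    f z = refl
  prodAt-replicate (suc n) f z = cong (f z *_) (prodAt-replicate n f z)

  prodSum-replicate : ∀ zs n f → prodSum zs (replicate n f) ≡ ∑ zs f ^ n
  prodSum-replicate zs zero    f = refl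
  prodSum-replicate zs (suc n) f = cong (∑ zs f *_) (prodSum-replicate zs n f)

  private
    pairs : Z → List Z → List (Z → ℕ) → List (ℕ × ℕ)
    pairs z zs = map (λ f → f z , ∑ zs f)

    fsts-pairs : ∀ z zs fs → fsts (pairs z zs fs) ≡ prodAt fs z
    fsts-pairs z zs []       = refl
    fsts-pairs z zs (f ∷ fs) = cong (f z *_) (fsts-pairs z zs fs)

    snds-pairs : ∀ z zs fs → snds (pairs z zs fs) ≡ prodSum zs fs
    snds-pairs z zs []       = refl
    snds-pairs z zs (f ∷ fs) = cong (∑ zs f *_) (snds-pairs z zs fs)

    tots-pairs : ∀ z zs fs → tots (pairs z zs fs) ≡ prodSum (z ∷ zs) fs
    tots-pairs z zs []       = refl
    tots-pairs z zs (f ∷ fs) = cong (∑ (z ∷ zs) f *_) (tots-pairs z zs fs)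

    length-pairs : ∀ z zs fs → length (pairs z zs fs) ≡ length fs
    length-pairs z zs []       = refl
    length-pairs z zs (f ∷ fs) = cong suc (length-pairs z zs fs)

  -- Superadditivity of the geometric mean is Hölder's inequality for two points. The induction
  -- treats the tail of the list as a second point, at which `f` has the value `∑ zs f`.
  hölder : ∀ zs X fs → (∀ z → X z ^ length fs ≤ prodAt fs z) →
    ∑ zs X ^ length fs ≤ prodSum zs fs
  hölder []       X []       h = ≤-refl
  hölder []       X (f ∷ fs) h = z≤n
  hölder (z ∷ zs) X fs       h =
    subst (λ n → ∑ (z ∷ zs) X ^ n ≤ prodSum (z ∷ zs) fs) (length-pairs z zs fs)
      (≤-trans (geometric-mean-superadditive (X z) (∑ zs X) (pairs z zs fs) hx hy)
               (≤-reflexive (tots-pairs z zs fs)))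
    where
    hx : X z ^ length (pairs z zs fs) ≤ fsts (pairs z zs fs)
    hx rewrite length-pairs z zs fs | fsts-pairs z zs fs = h z
    hy : ∑ zs X ^ length (pairs z zs fs) ≤ snds (pairs z zs fs)
    hy rewrite length-pairs z zs fs | snds-pairs z zs fs = hölder zs X fs h

  -- The factor X is added so that points with X z = 0 impose no condition, even when fs is empty.
  hölder-scaled : ∀ zs X fs c C → (∀ z → 0 < X z → c * X z ^ length fs ≤ C * prodAt fs z) →
    0 < ∑ zs X → c * ∑ zs X ^ length fs ≤ C * prodSum zs fs
  hölder-scaled zs X fs zero      C h T>0 = z≤n
  hölder-scaled zs X fs c@(suc _) C h T>0 = *-cancelˡ-≤′ (c ^ N) (^-positive {c} N (s≤s z≤n)) (*-cancelˡ-≤′ T T>0 (begin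
    T * (c ^ N * (c * T ^ N))       ≡⟨ e₁ T (c ^ N) c (T ^ N) ⟩
    c * T * (c ^ N * T ^ N)         ≡⟨ cong (c * T *_) (*-^-distrib c T N) ⟨
    c * T * (c * T) ^ N             ≡⟨ cong (λ t → t ^ suc N) (∑-*ˡ zs c X) ⟨
    ∑ zs (λ z → c * X z) ^ suc N    ≤⟨ hölder zs (λ z → c * X z) ((λ z → c ^ N * C * X z) ∷ fs) pointwise ⟩
    ∑ zs (λ z → c ^ N * C * X z) * prodSum zs fs ≡⟨ cong (_* prodSum zs fs) (∑-*ˡ zs (c ^ N * C) X) ⟩
    c ^ N * C * T * prodSum zs fs   ≡⟨ e₂ (c ^ N) C T _ ⟩
    T * (c ^ N * (C * prodSum zs fs)) ∎))
    where
    open ≤-Reasoning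
    N = length fs
    T = ∑ zs X
    e₁ : ∀ t a c s → t * (a * (c * s)) ≡ c * t * (a * s)
    e₁ = solve-∀
    e₂ : ∀ a c t p → a * c * t * p ≡ t * (a * (c * p))
    e₂ = solve-∀
    pointwise : ∀ z → (c * X z) ^ suc N ≤ c ^ N * C * X z * prodAt fs z
    pointwise z with X z in eq
    ... | zero = subst (λ t → t * t ^ N ≤ c ^ N * C * 0 * prodAt fs z) (sym (*-zeroʳ c)) z≤n
    ... | x@(suc _) = begin
      c * x * (c * x) ^ N        ≡⟨ cong (c * x *_) (*-^-distrib c x N) ⟩
      c * x * (c ^ N * x ^ N)    ≡⟨ e₁ x (c ^ N) c (x ^ N) ⟨
      x * (c ^ N * (c * x ^ N))  ≤⟨ *-monoʳ-≤ x (*-monoʳ-≤ (c ^ N) (subst (λ t → c * t ^ N ≤ C * prodAt fs z) eq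
                                       (h z (subst (0 <_) (sym eq) (s≤s z≤n))))) ⟩
      x * (c ^ N * (C * prodAt fs z)) ≡⟨ e₂ (c ^ N) C x _ ⟨
      c ^ N * C * x * prodAt fs z ∎

  -- Hölder with conjugate exponents (i + j)/i and (i + j)/j for the weight `w`, obtained by
  -- repeating one factor `i` times and the other `j` times.
  hölder₂ : ∀ zs (w f g : Z → ℕ) i j →
    ∑ zs (λ z → w z * (f z ^ i * g z ^ j)) ^ (i + j)
      ≤ ∑ zs (λ z → w z * f z ^ (i + j)) ^ i * ∑ zs (λ z → w z * g z ^ (i + j)) ^ j
  hölder₂ zs w f g i j = begin
    ∑ zs X ^ (i + j)       ≡⟨ cong (∑ zs X ^_) len ⟨
    ∑ zs X ^ length fs     ≤⟨ hölder zs X fs pointwise ⟩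
    prodSum zs fs          ≡⟨ prodSum-++ zs (replicate i F) (replicate j G) ⟩
    prodSum zs (replicate i F) * prodSum zs (replicate j G)
                           ≡⟨ cong₂ _*_ (prodSum-replicate zs i F) (prodSum-replicate zs j G) ⟩
    ∑ zs F ^ i * ∑ zs G ^ j ∎
    where
    open ≤-Reasoning
    X F G : Z → ℕ
    X z = w z * (f z ^ i * g z ^ j)
    F z = w z * f z ^ (i + j)
    G z = w z * g z ^ (i + j)
    fs = replicate i F ++ replicate j G
    len : length fs ≡ i + j
    len = trans (length-++ (replicate i F)) (cong₂ _+_ (length-replicate i) (length-replicate j))
    powers : ∀ w f g → (w * (f ^ i * g ^ j)) ^ (i + j) ≡ (w * f ^ (i + j)) ^ i * (w * g ^ (i + j)) ^ j
    powers w f g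
      rewrite *-^-distrib w (f ^ i * g ^ j) (i + j)
            | *-^-distrib (f ^ i) (g ^ j) (i + j)
            | *-^-distrib w (f ^ (i + j)) i
            | *-^-distrib w (g ^ (i + j)) j
            | ^-distribˡ-+-* w i j
            | ^-*-assoc f i (i + j) | ^-*-assoc f (i + j) i
            | ^-*-assoc g j (i + j) | ^-*-assoc g (i + j) j
            | *-comm i (i + j) | *-comm j (i + j)
      = e (w ^ i) (w ^ j) (f ^ ((i + j) * i)) (g ^ ((i + j) * j))
      where
      e : ∀ a b c d → a * b * (c * d) ≡ a * c * (b * d)
      e = solve-∀
    pointwise : ∀ z → X z ^ length fs ≤ prodAt fs z
    pointwise z rewrite len | prodAt-++ (replicate i F) (replicate j G) z
                      | prodAt-replicate i F z | prodAt-replicate j G z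
      = ≤-reflexive (powers (w z) (f z) (g z))

-- Complete bipartite counts

prodF-cong : ∀ k {f g : Fin k → ℕ} → (∀ i → f i ≡ g i) → prodF k f ≡ prodF k g
prodF-cong zero    h = refl
prodF-cong (suc k) h = cong₂ _*_ (h zero) (prodF-cong k (λ i → h (suc i)))

prodF-mono : ∀ k {f g : Fin k → ℕ} → (∀ i → f i ≤ g i) → prodF k f ≤ prodF k g
prodF-mono zero    h = ≤-refl
prodF-mono (suc k) h = *-mono-≤ (h zero) (prodF-mono k (λ i → h (suc i)))

prodF-* : ∀ k (f g : Fin k → ℕ) → prodF k (λ i → f i * g i) ≡ prodF k f * prodF k g
prodF-* zero    f g = refl
prodF-* (suc k) f g = trans (cong (f zero * g zero *_) (prodF-* k _ _)) (e (f zero) (g zero) _ _)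
  where
  e : ∀ a b c d → a * b * (c * d) ≡ a * c * (b * d)
  e = solve-∀

prodF-const : ∀ k c → prodF k (λ _ → c) ≡ c ^ k
prodF-const zero    c = refl
prodF-const (suc k) c = cong (c *_) (prodF-const k c)

prodF-one : ∀ k → prodF k (λ _ → 1) ≡ 1
prodF-one k = trans (prodF-const k 1) (^-zeroˡ k)

prodF-^ : ∀ k (f : Fin k → ℕ) n → prodF k (λ i → f i ^ n) ≡ prodF k f ^ n
prodF-^ zero    f n = sym (^-zeroˡ n)
prodF-^ (suc k) f n = trans (cong (f zero ^ n *_) (prodF-^ k _ n)) (sym (*-^-distrib (f zero) _ n))

prodF-swap : ∀ k l (f : Fin k → Fin l → ℕ) →
  prodF k (λ i → prodF l (f i)) ≡ prodF l (λ j → prodF k (λ i → f i j))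
prodF-swap zero    l f = sym (prodF-one l)
prodF-swap (suc k) l f = trans (cong (prodF l (f zero) *_) (prodF-swap k l (λ i → f (suc i))))
                               (sym (prodF-* l (f zero) _))

∑-allMaps-suc : ∀ m q (f : (Fin (suc m) → Fin q) → ℕ) →
  ∑ (allMaps (suc m) q) f ≡ ∑ (allFin q) (λ c → ∑ (allMaps m q) (λ φ → f (c ∷ᶠ φ)))
∑-allMaps-suc m q f = trans (∑-concatMap (λ c → map (c ∷ᶠ_) (allMaps m q)) (allFin q) f)
  (∑-cong (allFin q) (λ c → ∑-map (c ∷ᶠ_) (allMaps m q) f))

∑-allMaps-prodF : ∀ m q (h : Fin m → Fin q → ℕ) →
  ∑ (allMaps m q) (λ φ → prodF m (λ i → h i (φ i))) ≡ prodF m (λ i → ∑ (allFin q) (h i))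
∑-allMaps-prodF zero    q h = refl
∑-allMaps-prodF (suc m) q h = trans (∑-allMaps-suc m q _)
  (trans (∑-cong (allFin q) (λ c → trans (∑-*ˡ (allMaps m q) (h zero c) _)
                                         (cong (h zero c *_) (∑-allMaps-prodF m q (λ i → h (suc i))))))
         (∑-*ʳ (allFin q) _ (h zero)))

∑-^ : ∀ m q (h : Fin q → ℕ) →
  ∑ (allFin q) h ^ m ≡ ∑ (allMaps m q) (λ φ → prodF m (λ i → h (φ i)))
∑-^ m q h = trans (sym (prodF-const m _)) (sym (∑-allMaps-prodF m q (λ _ → h)))

module Kernel (q : ℕ) (r : Fin q → Fin q → ℕ) (r-sym : ∀ x y → r x y ≡ r y x) where

  Weight : Set
  Weight = Fin q → ℕ

  mass : Weight → ℕ
  mass = ∑ (allFin q)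

  nbr : ∀ p → (Fin p → Fin q) → Weight → ℕ
  nbr p x β = mass (λ y → β y * prodF p (λ i → r (x i) y))

  -- p counts the α-vertices, which have degree s: for an edge uv the relevant count is
  -- bip d_v λ_u d_u λ_v.
  bip : ℕ → Weight → ℕ → Weight → ℕ
  bip p α s β = ∑ (allMaps p q) (λ x → prodF p (λ i → α (x i)) * nbr p x β ^ s)

  -- Both sides count the same weighted colourings: the power of `nbr` expands into a sum over
  -- tuples for the other part, and the two sums are exchanged.
  bip-sym : ∀ p α s β → bip p α s β ≡ bip s β p α
  bip-sym p α s β = begin
    bip p α s β
      ≡⟨ ∑-cong (allMaps p q) (λ x → cong (prodF p (λ i → α (x i)) *_) (∑-^ s q _)) ⟩
    ∑ (allMaps p q) (λ x → prodF p (λ i → α (x i)) *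
       ∑ (allMaps s q) (λ y → prodF s (λ j → β (y j) * prodF p (λ i → r (x i) (y j)))))
      ≡⟨ ∑-cong (allMaps p q) (λ x → sym (∑-*ˡ (allMaps s q) (prodF p (λ i → α (x i))) _)) ⟩
    ∑ (allMaps p q) (λ x → ∑ (allMaps s q) (λ y → prodF p (λ i → α (x i)) *
       prodF s (λ j → β (y j) * prodF p (λ i → r (x i) (y j)))))
      ≡⟨ ∑-swap (allMaps p q) (allMaps s q) _ ⟩
    ∑ (allMaps s q) (λ y → ∑ (allMaps p q) (λ x → prodF p (λ i → α (x i)) *
       prodF s (λ j → β (y j) * prodF p (λ i → r (x i) (y j)))))
      ≡⟨ ∑-cong (allMaps s q) (λ y → ∑-cong (allMaps p q) (λ x → exchange x y)) ⟩
    ∑ (allMaps s q) (λ y → ∑ (allMaps p q) (λ x → prodF s (λ j → β (y j)) *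
       prodF p (λ i → α (x i) * prodF s (λ j → r (y j) (x i)))))
      ≡⟨ ∑-cong (allMaps s q) (λ y → ∑-*ˡ (allMaps p q) (prodF s (λ j → β (y j))) _) ⟩
    ∑ (allMaps s q) (λ y → prodF s (λ j → β (y j)) *
       ∑ (allMaps p q) (λ x → prodF p (λ i → α (x i) * prodF s (λ j → r (y j) (x i)))))
      ≡⟨ ∑-cong (allMaps s q) (λ y → cong (prodF s (λ j → β (y j)) *_) (∑-^ p q _)) ⟨
    bip s β p α ∎
    where
    open ≡-Reasoning
    e : ∀ a b c → a * (b * c) ≡ b * (a * c)
    e = solve-∀
    exchange : ∀ x y → prodF p (λ i → α (x i)) * prodF s (λ j → β (y j) * prodF p (λ i → r (x i) (y j)))
                     ≡ prodF s (λ j → β (y j)) * prodF p (λ i → α (x i) * prodF s (λ j → r (y j) (x i)))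
    exchange x y = begin
      A * prodF s (λ j → β (y j) * prodF p (λ i → r (x i) (y j)))
        ≡⟨ cong (A *_) (prodF-* s _ _) ⟩
      A * (B * prodF s (λ j → prodF p (λ i → r (x i) (y j))))
        ≡⟨ e A B _ ⟩
      B * (A * prodF s (λ j → prodF p (λ i → r (x i) (y j))))
        ≡⟨ cong (λ t → B * (A * t)) (prodF-swap s p _) ⟩
      B * (A * prodF p (λ i → prodF s (λ j → r (x i) (y j))))
        ≡⟨ cong (λ t → B * (A * t)) (prodF-cong p (λ i → prodF-cong s (λ j → r-sym (x i) (y j)))) ⟩
      B * (A * prodF p (λ i → prodF s (λ j → r (y j) (x i))))
        ≡⟨ cong (B *_) (prodF-* p _ _) ⟨
      B * prodF p (λ i → α (x i) * prodF s (λ j → r (y j) (x i))) ∎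
      where
      A = prodF p (λ i → α (x i))
      B = prodF s (λ j → β (y j))

  -- With `F x = nbr b x β` this is the count `bip` for `α` restricted to the neighbours of `z`;
  -- with `F = 1` it is the `b`-th power of the restricted mass. One estimate thus serves both.
  link : ∀ b → Weight → ((Fin b → Fin q) → ℕ) → ℕ → Fin q → ℕ
  link b α F e z = ∑ (allMaps b q) (λ x → prodF b (λ i → α (x i) * r z (x i)) * F x ^ e)

  -- A dual form of a bound on ∑ lam z * S z ^ (Δ/b), where S = link b α F a′ and Δ = j + b:
  -- taking μ = S^{1/b} recovers it, while here all quantities are integers.
  link-bound : ∀ (lam μ : Weight) α b j a′ (F : (Fin b → Fin q) → ℕ) →
    mass (λ z → lam z * (μ z ^ j * link b α F a′ z)) ^ (suc a′ * (j + b))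
      ≤ ∑ (allMaps b q) (λ x → prodF b (λ i → α (x i)) * F x ^ suc a′) ^ (a′ * (j + b))
        * (bip (j + b) α (suc a′) lam ^ b * mass (λ z → lam z * μ z ^ (j + b)) ^ (suc a′ * j))
  link-bound lam μ α b j a′ F = begin
    W ^ (a * Δ)                              ≡⟨ cong (_^ (a * Δ)) W-eq ⟩
    W′ ^ (a * Δ)                             ≡⟨ ^-*-assoc W′ a Δ ⟨
    (W′ ^ a) ^ Δ                             ≤⟨ ^-monoˡ-≤ Δ first ⟩
    (X ^ a′ * V) ^ Δ                         ≡⟨ *-^-distrib (X ^ a′) V Δ ⟩
    (X ^ a′) ^ Δ * V ^ Δ                     ≡⟨ cong (_* V ^ Δ) (^-*-assoc X a′ Δ) ⟩
    X ^ (a′ * Δ) * V ^ Δ                     ≤⟨ *-monoʳ-≤ (X ^ (a′ * Δ)) second ⟩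
    X ^ (a′ * Δ) * (Y ^ b * T ^ (a * j))     ∎
    where
    open ≤-Reasoning
    a = suc a′
    Δ = j + b
    A : (Fin b → Fin q) → ℕ
    A x = prodF b (λ i → α (x i))
    lam′ : Weight
    lam′ z = lam z * μ z ^ j
    W = mass (λ z → lam z * (μ z ^ j * link b α F a′ z))
    W′ = ∑ (allMaps b q) (λ x → A x * (F x ^ a′ * nbr b x lam′ ^ 1))
    X = ∑ (allMaps b q) (λ x → A x * F x ^ a)
    V = ∑ (allMaps b q) (λ x → A x * nbr b x lam′ ^ a)
    Y = bip Δ α a lam
    T = mass (λ z → lam z * μ z ^ Δ)

    W-eq : W ≡ W′
    W-eq = begin-equality
      W ≡⟨ ∑-cong (allFin q) (λ z → trans (sym (*-assoc (lam z) (μ z ^ j) _)) (sym (∑-*ˡ (allMaps b q) (lam′ z) _))) ⟩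
      mass (λ z → ∑ (allMaps b q) (λ x → lam′ z * (prodF b (λ i → α (x i) * r z (x i)) * F x ^ a′)))
        ≡⟨ ∑-swap (allFin q) (allMaps b q) _ ⟩
      ∑ (allMaps b q) (λ x → mass (λ z → lam′ z * (prodF b (λ i → α (x i) * r z (x i)) * F x ^ a′)))
        ≡⟨ ∑-cong (allMaps b q) (λ x → ∑-cong (allFin q) (λ z → pull x z)) ⟩
      ∑ (allMaps b q) (λ x → mass (λ z → A x * F x ^ a′ * (lam′ z * prodF b (λ i → r (x i) z))))
        ≡⟨ ∑-cong (allMaps b q) (λ x → trans (∑-*ˡ (allFin q) (A x * F x ^ a′) _) (e₂ (A x) (F x ^ a′) (nbr b x lam′))) ⟩
      W′ ∎
      where
      e₁ : ∀ l a p f → l * (a * p * f) ≡ a * f * (l * p)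
      e₁ = solve-∀
      e₂ : ∀ a f v → a * f * v ≡ a * (f * (v * 1))
      e₂ = solve-∀
      pull : ∀ x z → lam′ z * (prodF b (λ i → α (x i) * r z (x i)) * F x ^ a′)
                   ≡ A x * F x ^ a′ * (lam′ z * prodF b (λ i → r (x i) z))
      pull x z = trans (cong (λ t → lam′ z * (t * F x ^ a′))
          (trans (prodF-* b _ _) (cong (A x *_) (prodF-cong b (λ i → r-sym z (x i))))))
        (e₁ (lam′ z) (A x) _ (F x ^ a′))

    -- Hölder over `x` separates `F` from the weights of the deleted vertex, and turns the exponent
    -- `a′` of `F` into `a`, the degree before deletion.
    first : W′ ^ a ≤ X ^ a′ * V
    first = subst (λ n → W′ ^ n ≤ X ^ a′ * V) (+-comm a′ 1)
      (≤-trans (hölder₂ (allMaps b q) A F (λ x → nbr b x lam′) a′ 1)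
        (≤-reflexive (cong₂ _*_
          (cong (λ n → ∑ (allMaps b q) (λ x → A x * F x ^ n) ^ a′) (+-comm a′ 1))
          (trans (*-identityʳ _) (cong (λ n → ∑ (allMaps b q) (λ x → A x * nbr b x lam′ ^ n)) (+-comm a′ 1))))))

    -- `V` equals `bip b α a lam′`. Read from the other part, it is a sum over `a`-tuples containing
    -- a `b`-th power of `nbr`; Hölder with exponents `j` and `b` raises this to a `Δ`-th power and
    -- collects the powers of `μ` in `T`.
    second : V ^ Δ ≤ Y ^ b * T ^ (a * j)
    second = begin
      V ^ Δ
        ≡⟨ cong (_^ Δ) (bip-sym b α a lam′) ⟩
      bip a lam′ b α ^ Δ
        ≡⟨ cong (_^ Δ) (∑-cong (allMaps a q) (λ z → trans
             (cong (_* nbr a z α ^ b) (trans (prodF-* a (λ i → lam (z i)) (λ i → μ (z i) ^ j)) (cong (prodF a (λ i → lam (z i)) *_) (prodF-^ a (λ i → μ (z i)) j))))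
             (*-assoc (prodF a (λ i → lam (z i))) _ _))) ⟩
      ∑ (allMaps a q) (λ z → prodF a (λ i → lam (z i)) * (prodF a (λ i → μ (z i)) ^ j * nbr a z α ^ b)) ^ Δ
        ≤⟨ hölder₂ (allMaps a q) (λ z → prodF a (λ i → lam (z i))) (λ z → prodF a (λ i → μ (z i))) (λ z → nbr a z α) j b ⟩
      ∑ (allMaps a q) (λ z → prodF a (λ i → lam (z i)) * prodF a (λ i → μ (z i)) ^ Δ) ^ j * bip a lam Δ α ^ b
        ≡⟨ cong₂ (λ s t → s ^ j * t ^ b)
             (trans (∑-cong (allMaps a q) (λ z → trans (cong (prodF a (λ i → lam (z i)) *_) (sym (prodF-^ a (λ i → μ (z i)) Δ))) (sym (prodF-* a (λ i → lam (z i)) (λ i → μ (z i) ^ Δ)))))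
                    (sym (∑-^ a q (λ z → lam z * μ z ^ Δ))))
             (bip-sym a lam Δ α) ⟩
      (T ^ a) ^ j * Y ^ b
        ≡⟨ cong (_* Y ^ b) (^-*-assoc T a j) ⟩
      T ^ (a * j) * Y ^ b
        ≡⟨ *-comm (T ^ (a * j)) (Y ^ b) ⟩
      Y ^ b * T ^ (a * j) ∎

-- Hölder certificates and integer roots

*-positiveʳ : ∀ x {y} → 0 < x * y → 0 < y
*-positiveʳ x {zero}  h = ⊥-elim (<-irrefl (sym (*-zeroʳ x)) h)
*-positiveʳ x {suc y} h = s≤s z≤n

module Costs (q : ℕ) (lam μ : Fin q → ℕ) (Δ : ℕ) where

  X : Fin q → ℕ
  X z = lam z * μ z ^ Δ

  T : ℕ
  T = ∑ (allFin q) X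

  -- A proof by Hölder's inequality that (∑ lam z * h z ^ (Δ/k))^{k/Δ} ≤ R, tested against the
  -- integer function μ in place of a power of h.
  record Cost (k : ℕ) (h : Fin q → ℕ) (R : ℕ) : Set where
    constructor certificate
    field
      coefficient : ℕ
      factors     : List (Fin q → ℕ)
      at-point    : ∀ z → h z * X z ^ length factors ≤ coefficient * (μ z ^ k * prodAt factors z)
      total       : (coefficient * prodSum (allFin q) factors) ^ Δ * T ^ k ≤ R ^ Δ * T ^ (Δ * length factors)

  cost-weaken : ∀ {k h h′ R R′} → (∀ z → h′ z ≤ h z) → R ≤ R′ → Cost k h R → Cost k h′ R′
  cost-weaken h′≤h R≤R′ (certificate C fs at total) = certificate C fs
    (λ z → ≤-trans (*-monoˡ-≤ (X z ^ length fs) (h′≤h z)) (at z))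
    (≤-trans total (*-monoˡ-≤ (T ^ (Δ * length fs)) (^-monoˡ-≤ Δ R≤R′)))

  cost-resp-≡ : ∀ {k k′ h R} → k ≡ k′ → Cost k h R → Cost k′ h R
  cost-resp-≡ refl c = c

  cost-const : ∀ c → Cost 0 (λ _ → c) c
  cost-const c = certificate c [] (λ z → ≤-refl)
    (≤-reflexive (cong₂ (λ s t → s ^ Δ * T ^ t) (*-identityʳ c) (sym (*-zeroʳ Δ))))

  -- Every factor is matched by one `X z` on the left of `at-point`, so certificates of different
  -- lengths can be concatenated; the exponents of `μ` add.
  cost-* : ∀ {k k′ h h′ R R′} → Cost k h R → Cost k′ h′ R′ → Cost (k + k′) (λ z → h z * h′ z) (R * R′)
  cost-* {k} {k′} {h} {h′} {R} {R′} (certificate C fs at total) (certificate C′ fs′ at′ total′) =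
    certificate (C * C′) (fs ++ fs′) at″ total″
    where
    open ≤-Reasoning
    P = prodSum (allFin q) fs
    P′ = prodSum (allFin q) fs′
    N = length fs
    N′ = length fs′
    e : ∀ a b c d → a * b * (c * d) ≡ a * c * (b * d)
    e = solve-∀
    e₂ : ∀ C C′ m m′ p p′ → C * (m * p) * (C′ * (m′ * p′)) ≡ C * C′ * (m * m′ * (p * p′))
    e₂ = solve-∀
    at″ : ∀ z → h z * h′ z * X z ^ length (fs ++ fs′) ≤ C * C′ * (μ z ^ (k + k′) * prodAt (fs ++ fs′) z)
    at″ z = begin
      h z * h′ z * X z ^ length (fs ++ fs′)       ≡⟨ cong (λ t → h z * h′ z * X z ^ t) (length-++ fs) ⟩
      h z * h′ z * X z ^ (N + N′)                 ≡⟨ cong (h z * h′ z *_) (^-distribˡ-+-* (X z) N N′) ⟩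
      h z * h′ z * (X z ^ N * X z ^ N′)           ≡⟨ e (h z) (h′ z) _ _ ⟩
      h z * X z ^ N * (h′ z * X z ^ N′)           ≤⟨ *-mono-≤ (at z) (at′ z) ⟩
      C * (μ z ^ k * prodAt fs z) * (C′ * (μ z ^ k′ * prodAt fs′ z)) ≡⟨ e₂ C C′ (μ z ^ k) (μ z ^ k′) _ _ ⟩
      C * C′ * (μ z ^ k * μ z ^ k′ * (prodAt fs z * prodAt fs′ z))
        ≡⟨ cong₂ (λ s t → C * C′ * (s * t)) (^-distribˡ-+-* (μ z) k k′) (prodAt-++ fs fs′ z) ⟨
      C * C′ * (μ z ^ (k + k′) * prodAt (fs ++ fs′) z) ∎
    total″ : (C * C′ * prodSum (allFin q) (fs ++ fs′)) ^ Δ * T ^ (k + k′) ≤ (R * R′) ^ Δ * T ^ (Δ * length (fs ++ fs′))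
    total″ = begin
      (C * C′ * prodSum (allFin q) (fs ++ fs′)) ^ Δ * T ^ (k + k′)
        ≡⟨ cong₂ _*_ (cong (_^ Δ) (trans (cong (C * C′ *_) (prodSum-++ (allFin q) fs fs′)) (e C C′ P P′))) (^-distribˡ-+-* T k k′) ⟩
      (C * P * (C′ * P′)) ^ Δ * (T ^ k * T ^ k′)
        ≡⟨ cong (_* (T ^ k * T ^ k′)) (*-^-distrib (C * P) (C′ * P′) Δ) ⟩
      (C * P) ^ Δ * (C′ * P′) ^ Δ * (T ^ k * T ^ k′)
        ≡⟨ e ((C * P) ^ Δ) ((C′ * P′) ^ Δ) (T ^ k) (T ^ k′) ⟩
      (C * P) ^ Δ * T ^ k * ((C′ * P′) ^ Δ * T ^ k′)
        ≤⟨ *-mono-≤ total total′ ⟩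
      R ^ Δ * T ^ (Δ * N) * (R′ ^ Δ * T ^ (Δ * N′))
        ≡⟨ e (R ^ Δ) (T ^ (Δ * N)) (R′ ^ Δ) (T ^ (Δ * N′)) ⟩
      R ^ Δ * R′ ^ Δ * (T ^ (Δ * N) * T ^ (Δ * N′))
        ≡⟨ cong₂ _*_ (*-^-distrib R R′ Δ) (^-distribˡ-+-* T (Δ * N) (Δ * N′)) ⟨
      (R * R′) ^ Δ * T ^ (Δ * N + Δ * N′)
        ≡⟨ cong (λ t → (R * R′) ^ Δ * T ^ t) (trans (cong (Δ *_) (length-++ fs)) (*-distribˡ-+ Δ N N′)) ⟨
      (R * R′) ^ Δ * T ^ (Δ * length (fs ++ fs′)) ∎

  cost-prodF : ∀ m {k : Fin m → ℕ} {h : Fin m → Fin q → ℕ} {R : Fin m → ℕ} → (∀ i → Cost (k i) (h i) (R i)) →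
    Cost (sumF m k) (λ z → prodF m (λ i → h i z)) (prodF m R)
  cost-prodF zero    costs = cost-const 1
  cost-prodF (suc m) costs = cost-* (costs zero) (cost-prodF m (λ i → costs (suc i)))

  -- When the exponent of `μ` has reached `κ * Δ`, the power of `μ` is at most a constant times
  -- `Q ^ κ`, which cancels against the lower bound on `h`. What is left is a plain Hölder
  -- inequality for `X`; `total`, after a Δ-th root, evaluates its right side.
  cost-bound : ∀ {κ h R} c (Q : Fin q → ℕ) D → 0 < κ → 0 < Δ → (∀ z → c * Q z ^ κ ≤ h z) →
    (∀ z → μ z ^ Δ ≤ D ^ Δ * Q z) → Cost (κ * Δ) h R → c * T ^ κ ≤ R * D ^ (Δ * κ)
  cost-bound {κ} {h} {R} c Q D κ>0 Δ>0 hQ hμ (certificate C fs at total) with T in T-eq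
  ... | zero = ≤-trans (≤-reflexive (trans (cong (c *_) (zero^ κ>0)) (*-zeroʳ c))) z≤n
    where
    zero^ : ∀ {k} → 0 < k → 0 ^ k ≡ 0
    zero^ (s≤s _) = refl
  ... | t@(suc _) = *-cancelˡ-≤′ (t ^ N) (^-positive N (s≤s z≤n)) (begin
      t ^ N * (c * t ^ κ)        ≡⟨ e₁ (t ^ N) c (t ^ κ) ⟩
      c * t ^ N * t ^ κ          ≤⟨ *-monoˡ-≤ (t ^ κ) scaled ⟩
      C * D ^ (Δ * κ) * P * t ^ κ ≡⟨ e₂ C (D ^ (Δ * κ)) P (t ^ κ) ⟩
      D ^ (Δ * κ) * (C * P * t ^ κ) ≤⟨ *-monoʳ-≤ (D ^ (Δ * κ)) rooted ⟩
      D ^ (Δ * κ) * (R * t ^ N)  ≡⟨ e₃ (D ^ (Δ * κ)) R (t ^ N) ⟩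
      t ^ N * (R * D ^ (Δ * κ))  ∎)
    where
    open ≤-Reasoning
    N = length fs
    P = prodSum (allFin q) fs
    e₁ : ∀ a b c → a * (b * c) ≡ b * a * c
    e₁ = solve-∀
    e₂ : ∀ a b c d → a * b * c * d ≡ b * (a * c * d)
    e₂ = solve-∀
    e₃ : ∀ a b c → a * (b * c) ≡ c * (b * a)
    e₃ = solve-∀
    e₄ : ∀ a b c → a * (b * c) ≡ b * (a * c)
    e₄ = solve-∀
    e₅ : ∀ a b c d → a * (b * c * d) ≡ c * (a * b * d)
    e₅ = solve-∀
    rooted : C * P * t ^ κ ≤ R * t ^ N
    rooted = ^-cancelˡ-≤ Δ Δ>0 (begin
      (C * P * t ^ κ) ^ Δ          ≡⟨ *-^-distrib (C * P) (t ^ κ) Δ ⟩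
      (C * P) ^ Δ * (t ^ κ) ^ Δ    ≡⟨ cong ((C * P) ^ Δ *_) (^-*-assoc t κ Δ) ⟩
      (C * P) ^ Δ * t ^ (κ * Δ)    ≤⟨ total ⟩
      R ^ Δ * t ^ (Δ * N)          ≡⟨ cong (λ s → R ^ Δ * t ^ s) (*-comm Δ N) ⟩
      R ^ Δ * t ^ (N * Δ)          ≡⟨ cong (R ^ Δ *_) (^-*-assoc t N Δ) ⟨
      R ^ Δ * (t ^ N) ^ Δ          ≡⟨ *-^-distrib R (t ^ N) Δ ⟨
      (R * t ^ N) ^ Δ              ∎)
    -- Where `X z` is positive so is `μ z ^ Δ`, hence also `Q z`, and the power of `Q z` may be
    -- cancelled.
    pointwise : ∀ z → 0 < X z → c * X z ^ N ≤ C * D ^ (Δ * κ) * prodAt fs z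
    pointwise z X>0 = *-cancelˡ-≤′ (Q z ^ κ) (^-positive κ Q>0) (begin
      Q z ^ κ * (c * X z ^ N)                       ≡⟨ e₁ (Q z ^ κ) c (X z ^ N) ⟩
      c * Q z ^ κ * X z ^ N                         ≤⟨ *-monoˡ-≤ (X z ^ N) (hQ z) ⟩
      h z * X z ^ N                                 ≤⟨ at z ⟩
      C * (μ z ^ (κ * Δ) * prodAt fs z)             ≡⟨ cong (λ s → C * (μ z ^ s * prodAt fs z)) (*-comm κ Δ) ⟩
      C * (μ z ^ (Δ * κ) * prodAt fs z)             ≡⟨ cong (λ s → C * (s * prodAt fs z)) (^-*-assoc (μ z) Δ κ) ⟨
      C * ((μ z ^ Δ) ^ κ * prodAt fs z)             ≤⟨ *-monoʳ-≤ C (*-monoˡ-≤ (prodAt fs z) (^-monoˡ-≤ κ (hμ z))) ⟩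
      C * ((D ^ Δ * Q z) ^ κ * prodAt fs z)         ≡⟨ cong (λ s → C * (s * prodAt fs z)) (trans (*-^-distrib (D ^ Δ) (Q z) κ) (cong (_* Q z ^ κ) (^-*-assoc D Δ κ))) ⟩
      C * (D ^ (Δ * κ) * Q z ^ κ * prodAt fs z)     ≡⟨ e₅ C (D ^ (Δ * κ)) (Q z ^ κ) (prodAt fs z) ⟩
      Q z ^ κ * (C * D ^ (Δ * κ) * prodAt fs z)     ∎)
      where
      Q>0 : 0 < Q z
      Q>0 = *-positiveʳ (D ^ Δ) (≤-trans (*-positiveʳ (lam z) X>0) (hμ z))
    scaled : c * t ^ N ≤ C * D ^ (Δ * κ) * P
    scaled = subst (λ s → c * s ^ N ≤ C * D ^ (Δ * κ) * P) T-eq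
      (hölder-scaled (allFin q) X fs c (C * D ^ (Δ * κ)) pointwise (subst (0 <_) (sym T-eq) (s≤s z≤n)))

integer-root : ∀ k → 0 < k → ∀ m → ∃ λ s → s ^ k ≤ m × m < suc s ^ k
integer-root k@(suc k′) k>0 zero    = 0 , z≤n , ≤-reflexive (sym (^-zeroˡ k))
integer-root k k>0 (suc m) with integer-root k k>0 m
... | s , lo , hi with suc s ^ k ≤? suc m
...   | yes p = suc s , p , ≤-<-trans hi (^-monoˡ-< k {{>-nonZero k>0}} (n<1+n (suc s)))
...   | no ¬p = s , ≤-trans lo (n≤1+n m) , ≰⇒> ¬p

-- Bernoulli's inequality (D/(D + 1))^k ≥ 1 - k/(D + 1), multiplied out.
bernoulli-ratio : ∀ D k → suc D ^ k * suc D ≤ D ^ k * suc D + k * suc D ^ k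
bernoulli-ratio D zero    = ≤-reflexive (sym (+-identityʳ _))
bernoulli-ratio D (suc k) = begin
  suc D * s * suc D                          ≡⟨ *-assoc (suc D) s (suc D) ⟩
  suc D * (s * suc D)                        ≤⟨ *-monoʳ-≤ (suc D) (bernoulli-ratio D k) ⟩
  suc D * (p * suc D + k * s)                ≡⟨ e₁ D p k s ⟩
  D * p * suc D + suc D * p + k * (suc D * s) ≤⟨ +-monoˡ-≤ (k * (suc D * s))
                                                (+-monoʳ-≤ (D * p * suc D) (*-monoʳ-≤ (suc D) (^-monoˡ-≤ k (n≤1+n D)))) ⟩
  D * p * suc D + suc D * s + k * (suc D * s) ≡⟨ +-assoc (D * p * suc D) _ _ ⟩
  D * p * suc D + suc k * (suc D * s)        ∎
  where
  open ≤-Reasoning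
  s = suc D ^ k
  p = D ^ k
  e₁ : ∀ D p k s → suc D * (p * suc D + k * s) ≡ D * p * suc D + suc D * p + k * (suc D * s)
  e₁ = solve-∀

-- If `x` were at least `y + 1`, then (D/(D + 1))^k would be at most y/(y + 1) for every positive D,
-- and `bernoulli-ratio` would bound D.
ratio-limit : ∀ k x y → (∀ D → 0 < D → D ^ k * x ≤ suc D ^ k * y) → x ≤ y
ratio-limit k x y h with x ≤? y
... | yes x≤y = x≤y
... | no  x≰y = ⊥-elim (<⇒≱ (n<1+n (k * suc y)) (≤-trans (n≤1+n _) D+1≤k[1+y]))
  where
  open ≤-Reasoning
  -- Chosen to exceed the bound `k * suc y` that the assumption forces on `suc D`.
  D = suc (k * suc y)
  s = suc D ^ k
  p = D ^ k
  e₁ : ∀ s D y → s * (y * suc D + suc D) ≡ s * suc D * suc y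
  e₁ = solve-∀
  e₂ : ∀ p D k s y → (p * suc D + k * s) * suc y ≡ p * suc y * suc D + s * (k * suc y)
  e₂ = solve-∀
  e₃ : ∀ s y D t → s * y * suc D + s * t ≡ s * (y * suc D + t)
  e₃ = solve-∀
  D+1≤k[1+y] : suc D ≤ k * suc y
  D+1≤k[1+y] = +-cancelˡ-≤ (y * suc D) _ _ (*-cancelˡ-≤′ s (^-positive k (s≤s z≤n)) (begin
    s * (y * suc D + suc D)            ≡⟨ e₁ s D y ⟩
    s * suc D * suc y                  ≤⟨ *-monoˡ-≤ (suc y) (bernoulli-ratio D k) ⟩
    (p * suc D + k * s) * suc y        ≡⟨ e₂ p D k s y ⟩
    p * suc y * suc D + s * (k * suc y) ≤⟨ +-monoˡ-≤ (s * (k * suc y)) (*-monoˡ-≤ (suc D)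
                                            (≤-trans (*-monoʳ-≤ p (≰⇒> x≰y)) (h D (s≤s z≤n)))) ⟩
    s * y * suc D + s * (k * suc y)    ≡⟨ e₃ s y D (k * suc y) ⟩
    s * (y * suc D + k * suc y)        ∎))

-- Real Δ-th roots of Q are replaced by integers μ with μ/D ≤ Q^{1/Δ}, and D → ∞.
root-approximation : ∀ q (lam Q : Fin q → ℕ) Δ κ c R → 0 < Δ →
  (∀ D (μ : Fin q → ℕ) → (∀ z → μ z ^ Δ ≤ D ^ Δ * Q z) →
     c * ∑ (allFin q) (λ z → lam z * μ z ^ Δ) ^ κ ≤ R * D ^ (Δ * κ)) →
  c * ∑ (allFin q) (λ z → lam z * Q z) ^ κ ≤ R
root-approximation q lam Q Δ κ c R Δ>0 h = ratio-limit (Δ * κ) _ _ λ D D>0 →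
  let μ = λ z → proj₁ (integer-root Δ Δ>0 (D ^ Δ * Q z))
      μ≤ = λ z → proj₁ (proj₂ (integer-root Δ Δ>0 (D ^ Δ * Q z)))
      μ> = λ z → proj₂ (proj₂ (integer-root Δ Δ>0 (D ^ Δ * Q z)))
      d = D ^ Δ
      S = ∑ (allFin q) (λ z → lam z * Q z)
      T = ∑ (allFin q) (λ z → lam z * μ z ^ Δ)
      pointwise : ∀ z → d * d * (lam z * Q z) ≤ suc D ^ Δ * (lam z * μ z ^ Δ)
      pointwise z = ≤-trans (≤-reflexive (e₁ d (lam z) (Q z)))
        (≤-trans (*-monoʳ-≤ (lam z) (approx D D>0 (μ z) (Q z) (μ≤ z) (μ> z)))
          (≤-reflexive (e₂ (lam z) (suc D ^ Δ) (μ z ^ Δ))))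
      summed : d * d * S ≤ suc D ^ Δ * T
      summed = ≤-trans (≤-reflexive (sym (∑-*ˡ (allFin q) (d * d) _)))
        (≤-trans (∑-mono (allFin q) pointwise) (≤-reflexive (∑-*ˡ (allFin q) (suc D ^ Δ) _)))
      δ = D ^ (Δ * κ)
  in *-cancelˡ-≤′ δ (^-positive (Δ * κ) D>0) (begin
      δ * (δ * (c * S ^ κ))            ≡⟨ e₃ δ c (S ^ κ) ⟩
      c * (δ * δ * S ^ κ)              ≡⟨ cong (λ t → c * (t * t * S ^ κ)) (^-*-assoc D Δ κ) ⟨
      c * (d ^ κ * d ^ κ * S ^ κ)      ≡⟨ cong (λ t → c * (t * S ^ κ)) (*-^-distrib d d κ) ⟨
      c * ((d * d) ^ κ * S ^ κ)        ≡⟨ cong (c *_) (*-^-distrib (d * d) S κ) ⟨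
      c * (d * d * S) ^ κ              ≤⟨ *-monoʳ-≤ c (^-monoˡ-≤ κ summed) ⟩
      c * (suc D ^ Δ * T) ^ κ          ≡⟨ cong (c *_) (*-^-distrib (suc D ^ Δ) T κ) ⟩
      c * ((suc D ^ Δ) ^ κ * T ^ κ)    ≡⟨ cong (λ t → c * (t * T ^ κ)) (^-*-assoc (suc D) Δ κ) ⟩
      c * (suc D ^ (Δ * κ) * T ^ κ)    ≡⟨ e₂ c (suc D ^ (Δ * κ)) (T ^ κ) ⟩
      suc D ^ (Δ * κ) * (c * T ^ κ)    ≤⟨ *-monoʳ-≤ (suc D ^ (Δ * κ)) (h D μ μ≤) ⟩
      suc D ^ (Δ * κ) * (R * δ)        ≡⟨ e₄ (suc D ^ (Δ * κ)) R δ ⟩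
      δ * (suc D ^ (Δ * κ) * R)        ∎)
  where
  open ≤-Reasoning
  e₁ : ∀ d l x → d * d * (l * x) ≡ l * (d * (d * x))
  e₁ = solve-∀
  e₂ : ∀ a b c → a * (b * c) ≡ b * (a * c)
  e₂ = solve-∀
  e₃ : ∀ δ c s → δ * (δ * (c * s)) ≡ c * (δ * δ * s)
  e₃ = solve-∀
  e₄ : ∀ a b c → a * (b * c) ≡ c * (a * b)
  e₄ = solve-∀
  -- For positive `x` the root satisfies `s ≥ D`, so passing from `s` to `suc s` costs a factor of
  -- at most (D + 1)/D; another such factor cannot arise when `x = 0`, where the left side vanishes.
  approx : ∀ D → 0 < D → ∀ s x → s ^ Δ ≤ D ^ Δ * x → D ^ Δ * x < suc s ^ Δ →
    D ^ Δ * (D ^ Δ * x) ≤ suc D ^ Δ * s ^ Δ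
  approx D D>0 s zero    lo hi = ≤-trans (≤-reflexive (trans (cong (D ^ Δ *_) (*-zeroʳ (D ^ Δ))) (*-zeroʳ (D ^ Δ)))) z≤n
  approx D D>0 s x@(suc _) lo hi = begin
    D ^ Δ * (D ^ Δ * x)  ≤⟨ *-monoʳ-≤ (D ^ Δ) (<⇒≤ hi) ⟩
    D ^ Δ * suc s ^ Δ    ≡⟨ *-^-distrib D (suc s) Δ ⟨
    (D * suc s) ^ Δ      ≤⟨ ^-monoˡ-≤ Δ (≤-trans (≤-reflexive (*-suc D s)) (+-monoˡ-≤ (D * s) D≤s)) ⟩
    (suc D * s) ^ Δ      ≡⟨ *-^-distrib (suc D) s Δ ⟩
    suc D ^ Δ * s ^ Δ    ∎
    where
    D≤s : D ≤ s
    D≤s with D ≤? s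
    ... | yes p = p
    ... | no ¬p = ⊥-elim (<⇒≱ hi (≤-trans (^-monoˡ-≤ Δ (≰⇒> ¬p)) (m≤m*n (D ^ Δ) x)))

-- Deleting a colour

-- The last condition says that a colour incompatible with z is compatible with every neighbour of z;
-- it is what distinguishes the semiproper colourings from general homomorphism targets.
module Semiproper (q : ℕ) (r : Fin q → Fin q → ℕ) (r-sym : ∀ x y → r x y ≡ r y x)
  (r-01 : ∀ x y → r x y ≡ 0 ⊎ r x y ≡ 1)
  (r-compat : ∀ z x y → r z x ≡ 1 → r z y ≡ 0 → r x y ≡ 1) where

  open Kernel q r r-sym public

  restrict : Fin q → Weight → Weight
  restrict z α x = α x * r z x

  r≤1 : ∀ x y → r x y ≤ 1
  r≤1 x y with r-01 x y
  ... | inj₁ eq = ≤-trans (≤-reflexive eq) z≤n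
  ... | inj₂ eq = ≤-reflexive eq

  prodF-r≤1 : ∀ p (x : Fin p → Fin q) y → prodF p (λ i → r (x i) y) ≤ 1
  prodF-r≤1 p x y = ≤-trans (prodF-mono p (λ i → r≤1 (x i) y)) (≤-reflexive (prodF-one p))

  -- Allows the compatibility hypothesis of `nbr-density` to be assumed: a tuple violating it has
  -- restricted weight zero.
  supported : ∀ b z α (x : Fin b → Fin q) →
    prodF b (λ i → restrict z α (x i)) ≡ 0 ⊎ (∀ i → r z (x i) ≡ 1)
  supported zero    z α x = inj₂ λ ()
  supported (suc b) z α x with r-01 z (x zero) | supported b z α (λ i → x (suc i))
  ... | inj₁ eq | _      rewrite eq | *-zeroʳ (α (x zero)) = inj₁ refl
  ... | inj₂ _  | inj₁ p = inj₁ (trans (cong (restrict z α (x zero) *_) p) (*-zeroʳ (restrict z α (x zero))))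
  ... | inj₂ eq | inj₂ p = inj₂ λ { zero → eq ; (suc i) → p i }

  -- Colours removed from β are compatible with all of x, so removing them can only lower the density.
  nbr-density : ∀ b z β (x : Fin b → Fin q) → (∀ i → r z (x i) ≡ 1) →
    nbr b x (restrict z β) * mass β ≤ nbr b x β * mass (restrict z β)
  nbr-density b z β x x~z = begin
    F * mass β               ≡⟨ cong (F *_) mass-split ⟩
    F * (M + G)              ≡⟨ *-distribˡ-+ F M G ⟩
    F * M + F * G            ≤⟨ +-monoʳ-≤ (F * M) (*-monoˡ-≤ G F≤M) ⟩
    F * M + M * G            ≡⟨ e₁ F M G ⟩
    (F + G) * M              ≡⟨ cong (_* M) nbr-split ⟨
    nbr b x β * M            ∎
    where
    open ≤-Reasoning
    γ : Weight
    γ y = β y * (1 ∸ r z y)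
    F = nbr b x (restrict z β)
    M = mass (restrict z β)
    G = mass γ
    e₁ : ∀ F M G → F * M + M * G ≡ (F + G) * M
    e₁ = solve-∀
    mass-split : mass β ≡ M + G
    mass-split = trans (∑-cong (allFin q) split) (∑-+ (allFin q) (restrict z β) γ)
      where
      split : ∀ y → β y ≡ restrict z β y + γ y
      split y = trans (sym (*-identityʳ (β y))) (trans (cong (β y *_) (sym (m+[n∸m]≡n (r≤1 z y)))) (*-distribˡ-+ (β y) _ _))
    F≤M : F ≤ M
    F≤M = ∑-mono (allFin q) (λ y → ≤-trans (*-monoʳ-≤ (restrict z β y) (prodF-r≤1 b x y)) (≤-reflexive (*-identityʳ _)))
    nbr-split : nbr b x β ≡ F + G
    nbr-split = trans (∑-cong (allFin q) split) (∑-+ (allFin q) (λ y → restrict z β y * prodF b (λ i → r (x i) y)) γ)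
      where
      split : ∀ y → β y * prodF b (λ i → r (x i) y) ≡ restrict z β y * prodF b (λ i → r (x i) y) + γ y
      split y with r-01 z y
      ... | inj₂ eq rewrite eq | *-identityʳ (β y) | *-zeroʳ (β y) = sym (+-identityʳ _)
      ... | inj₁ eq rewrite eq | *-zeroʳ (β y) =
        cong (β y *_) (trans (prodF-cong b (λ i → r-compat z (x i) y (x~z i) eq)) (prodF-one b))

  -- Holds term by term: `nbr-density`, raised to the power `a`, for each tuple whose colours are
  -- all compatible with `z`.
  bip-restrict-density : ∀ b a z α β →
    bip b (restrict z α) a (restrict z β) * mass β ^ a ≤ bip b (restrict z α) a β * mass (restrict z β) ^ a
  bip-restrict-density b a z α β =
    ≤-trans (≤-reflexive (sym (∑-*ʳ (allMaps b q) (mass β ^ a) _)))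
    (≤-trans (∑-mono (allMaps b q) pointwise)
             (≤-reflexive (∑-*ʳ (allMaps b q) (mass (restrict z β) ^ a) _)))
    where
    open ≤-Reasoning
    pointwise : ∀ x →
      prodF b (λ i → restrict z α (x i)) * nbr b x (restrict z β) ^ a * mass β ^ a
      ≤ prodF b (λ i → restrict z α (x i)) * nbr b x β ^ a * mass (restrict z β) ^ a
    pointwise x with supported b z α x
    ... | inj₁ eq rewrite eq = z≤n
    ... | inj₂ x~z = begin
      A * nbr b x (restrict z β) ^ a * mass β ^ a   ≡⟨ *-assoc A _ _ ⟩
      A * (nbr b x (restrict z β) ^ a * mass β ^ a) ≡⟨ cong (A *_) (*-^-distrib (nbr b x (restrict z β)) (mass β) a) ⟨
      A * (nbr b x (restrict z β) * mass β) ^ a     ≤⟨ *-monoʳ-≤ A (^-monoˡ-≤ a (nbr-density b z β x x~z)) ⟩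
      A * (nbr b x β * mass (restrict z β)) ^ a     ≡⟨ cong (A *_) (*-^-distrib (nbr b x β) (mass (restrict z β)) a) ⟩
      A * (nbr b x β ^ a * mass (restrict z β) ^ a) ≡⟨ *-assoc A _ _ ⟨
      A * nbr b x β ^ a * mass (restrict z β) ^ a   ∎
      where
      A = prodF b (λ i → restrict z α (x i))

  -- Seen from the `β`-part, the count is a `b`-th moment of `nbr` under a measure of total mass
  -- `mass β ^ a`; normalised moments increase with `b`.
  bip-power-mean : ∀ b α a β → bip b α a β ^ suc b ≤ bip (suc b) α a β ^ b * mass β ^ a
  bip-power-mean b α a β = begin
    bip b α a β ^ suc b        ≡⟨ cong₂ _^_ (trans (bip-sym b α a β) (∑-cong (allMaps a q) (λ y → cong (B y *_) (pad (nbr a y α ^ b))))) (+-comm 1 b) ⟩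
    ∑ (allMaps a q) (λ y → B y * (nbr a y α ^ b * 1 ^ 1)) ^ (b + 1)
                               ≤⟨ hölder₂ (allMaps a q) B (λ y → nbr a y α) (λ _ → 1) b 1 ⟩
    ∑ (allMaps a q) (λ y → B y * nbr a y α ^ (b + 1)) ^ b * ∑ (allMaps a q) (λ y → B y * 1 ^ (b + 1)) ^ 1
                               ≡⟨ cong₂ (λ s t → s ^ b * t)
                                    (trans (cong (λ n → bip a β n α) (+-comm b 1)) (bip-sym a β (suc b) α))
                                    (trans (*-identityʳ _) (trans (∑-cong (allMaps a q) (λ y → trans (cong (B y *_) (^-zeroˡ (b + 1))) (*-identityʳ _)))
                                                                   (sym (∑-^ a q β)))) ⟩
    bip (suc b) α a β ^ b * mass β ^ a ∎
    where
    open ≤-Reasoning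
    B : (Fin a → Fin q) → ℕ
    B y = prodF a (λ i → β (y i))
    pad : ∀ t → t ≡ t * (1 * 1)
    pad t = sym (*-identityʳ t)

  -- The inequality between normalised counts for an edge inside N(w), raised to the power
  -- `a * b * suc b`; the powers of `mass (restrict z α)` cancel. The power mean raises `b` to
  -- `suc b`, then the density comparison undoes the restriction of `β`.
  bip-restrict-both : ∀ b a z α β →
    bip b (restrict z α) a (restrict z β) ^ suc b * mass β ^ (a * b)
      ≤ bip (suc b) (restrict z α) a β ^ b * mass (restrict z β) ^ (a * suc b)
  bip-restrict-both b a z α β = begin
    N₁ ^ suc b * mass β ^ (a * b)                  ≤⟨ *-monoˡ-≤ (mass β ^ (a * b)) (bip-power-mean b (restrict z α) a (restrict z β)) ⟩
    N₂ ^ b * m ^ a * mass β ^ (a * b)              ≡⟨ cong (N₂ ^ b * m ^ a *_) (^-*-assoc (mass β) a b) ⟨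
    N₂ ^ b * m ^ a * (mass β ^ a) ^ b              ≡⟨ e₁ (N₂ ^ b) (m ^ a) _ ⟩
    m ^ a * (N₂ ^ b * (mass β ^ a) ^ b)            ≡⟨ cong (m ^ a *_) (*-^-distrib N₂ (mass β ^ a) b) ⟨
    m ^ a * (N₂ * mass β ^ a) ^ b                  ≤⟨ *-monoʳ-≤ (m ^ a) (^-monoˡ-≤ b (bip-restrict-density (suc b) a z α β)) ⟩
    m ^ a * (N₃ * m ^ a) ^ b                       ≡⟨ cong (m ^ a *_) (*-^-distrib N₃ (m ^ a) b) ⟩
    m ^ a * (N₃ ^ b * (m ^ a) ^ b)                 ≡⟨ e₂ (m ^ a) (N₃ ^ b) _ ⟩
    N₃ ^ b * (m ^ a) ^ suc b                       ≡⟨ cong (N₃ ^ b *_) (^-*-assoc m a (suc b)) ⟩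
    N₃ ^ b * m ^ (a * suc b)                       ∎
    where
    open ≤-Reasoning
    N₁ = bip b (restrict z α) a (restrict z β)
    N₂ = bip (suc b) (restrict z α) a (restrict z β)
    N₃ = bip (suc b) (restrict z α) a β
    m = mass (restrict z β)
    e₁ : ∀ a b c → a * b * c ≡ b * (a * c)
    e₁ = solve-∀
    e₂ : ∀ a b c → a * (b * c) ≡ b * (a * c)
    e₂ = solve-∀

  module LinkCosts (lam μ : Weight) (Δ : ℕ) where
    open Costs q lam μ Δ public

    -- The certificate repeats the single factor of `link-bound`. The exponent is a multiple of
    -- `suc a′ * Δ` so that the resulting bound has integer powers; `m` is left free to match the
    -- scaled exponents used later.
    cost-link : ∀ α b j a′ (F : (Fin b → Fin q) → ℕ) m → j + b ≡ Δ →
      Cost (b * (suc a′ * Δ * m)) (λ z → link b α F a′ z ^ (suc a′ * Δ * m))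
        (∑ (allMaps b q) (λ x → prodF b (λ i → α (x i)) * F x ^ suc a′) ^ (a′ * Δ * m)
          * bip Δ α (suc a′) lam ^ (b * m))
    cost-link α b j a′ F m refl = certificate 1 (replicate e f) at-point total
      where
      open ≤-Reasoning
      a = suc a′
      e = a * Δ * m
      S = link b α F a′
      f : Weight
      f z = lam z * (μ z ^ j * S z)
      W = mass f
      A = ∑ (allMaps b q) (λ x → prodF b (λ i → α (x i)) * F x ^ suc a′)
      Y = bip Δ α (suc a′) lam
      e₁ : ∀ s l m n → s * (l * (m * n)) ≡ 1 * (n * (l * (m * s)))
      e₁ = solve-∀
      at-point : ∀ z → S z ^ e * X z ^ length (replicate e f) ≤ 1 * (μ z ^ (b * e) * prodAt (replicate e f) z)
      at-point z = ≤-reflexive (begin-equality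
        S z ^ e * X z ^ length (replicate e f)   ≡⟨ cong (λ n → S z ^ e * X z ^ n) (length-replicate e) ⟩
        S z ^ e * X z ^ e                        ≡⟨ *-^-distrib (S z) (X z) e ⟨
        (S z * (lam z * μ z ^ (j + b))) ^ e      ≡⟨ cong (λ t → (S z * (lam z * t)) ^ e) (^-distribˡ-+-* (μ z) j b) ⟩
        (S z * (lam z * (μ z ^ j * μ z ^ b))) ^ e ≡⟨ cong (_^ e) (e₁ (S z) (lam z) (μ z ^ j) (μ z ^ b)) ⟩
        (1 * (μ z ^ b * f z)) ^ e                ≡⟨ cong (_^ e) (*-identityˡ _) ⟩
        (μ z ^ b * f z) ^ e                      ≡⟨ *-^-distrib (μ z ^ b) (f z) e ⟩
        (μ z ^ b) ^ e * f z ^ e                  ≡⟨ cong₂ _*_ (^-*-assoc (μ z) b e) (sym (prodAt-replicate e f z)) ⟩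
        μ z ^ (b * e) * prodAt (replicate e f) z ≡⟨ *-identityˡ _ ⟨
        1 * (μ z ^ (b * e) * prodAt (replicate e f) z) ∎)
      x₁ : ∀ a d m → a * d * m * d ≡ a * d * (d * m)
      x₁ = solve-∀
      x₂ : ∀ b d m → b * (d * m) ≡ b * m * d
      x₂ = solve-∀
      x₃ : ∀ a j b m → a * j * ((j + b) * m) + b * (a * (j + b) * m) ≡ (j + b) * (a * (j + b) * m)
      x₃ = solve-∀
      p₁ : ∀ a b c d → a * (b * c) * d ≡ a * b * (c * d)
      p₁ = solve-∀
      total : (1 * prodSum (allFin q) (replicate e f)) ^ Δ * T ^ (b * e)
            ≤ (A ^ (a′ * Δ * m) * Y ^ (b * m)) ^ Δ * T ^ (Δ * length (replicate e f))
      total = begin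
        (1 * prodSum (allFin q) (replicate e f)) ^ Δ * T ^ (b * e)
          ≡⟨ cong (λ t → t ^ Δ * T ^ (b * e)) (trans (*-identityˡ _) (prodSum-replicate (allFin q) e f)) ⟩
        (W ^ e) ^ Δ * T ^ (b * e)
          ≡⟨ cong (_* T ^ (b * e)) (trans (^-*-assoc W e Δ) (trans (cong (W ^_) (x₁ a Δ m)) (sym (^-*-assoc W (a * Δ) (Δ * m))))) ⟩
        (W ^ (a * Δ)) ^ (Δ * m) * T ^ (b * e)
          ≤⟨ *-monoˡ-≤ (T ^ (b * e)) (^-monoˡ-≤ (Δ * m) (link-bound lam μ α b j a′ F)) ⟩
        (A ^ (a′ * Δ) * (Y ^ b * T ^ (a * j))) ^ (Δ * m) * T ^ (b * e)
          ≡⟨ cong (_* T ^ (b * e)) (trans (*-^-distrib (A ^ (a′ * Δ)) _ (Δ * m)) (cong ((A ^ (a′ * Δ)) ^ (Δ * m) *_) (*-^-distrib (Y ^ b) _ (Δ * m)))) ⟩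
        (A ^ (a′ * Δ)) ^ (Δ * m) * ((Y ^ b) ^ (Δ * m) * (T ^ (a * j)) ^ (Δ * m)) * T ^ (b * e)
          ≡⟨ p₁ ((A ^ (a′ * Δ)) ^ (Δ * m)) _ _ _ ⟩
        (A ^ (a′ * Δ)) ^ (Δ * m) * (Y ^ b) ^ (Δ * m) * ((T ^ (a * j)) ^ (Δ * m) * T ^ (b * e))
          ≡⟨ cong₂ _*_ (cong₂ _*_
               (trans (^-*-assoc A (a′ * Δ) (Δ * m)) (trans (cong (A ^_) (sym (x₁ a′ Δ m))) (sym (^-*-assoc A (a′ * Δ * m) Δ))))
               (trans (^-*-assoc Y b (Δ * m)) (trans (cong (Y ^_) (x₂ b Δ m)) (sym (^-*-assoc Y (b * m) Δ)))))
               (trans (cong (_* T ^ (b * e)) (^-*-assoc T (a * j) (Δ * m))) (trans (sym (^-distribˡ-+-* T (a * j * (Δ * m)) (b * e))) (cong (T ^_) (x₃ a j b m)))) ⟩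
        (A ^ (a′ * Δ * m)) ^ Δ * (Y ^ (b * m)) ^ Δ * T ^ (Δ * e)
          ≡⟨ cong₂ _*_ (*-^-distrib (A ^ (a′ * Δ * m)) (Y ^ (b * m)) Δ) (cong (λ n → T ^ (Δ * n)) (length-replicate e)) ⟨
        (A ^ (a′ * Δ * m) * Y ^ (b * m)) ^ Δ * T ^ (Δ * length (replicate e f)) ∎

    cost-bip : ∀ α b a′ β m → b ≤ Δ →
      Cost (b * (suc a′ * Δ * m)) (λ z → bip b (restrict z α) a′ β ^ (suc a′ * Δ * m))
        (bip b α (suc a′) β ^ (a′ * Δ * m) * bip Δ α (suc a′) lam ^ (b * m))
    cost-bip α b a′ β m b≤Δ = cost-link α b (Δ ∸ b) a′ (λ x → nbr b x β) m (m∸n+n≡m b≤Δ)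

    -- The case `b = Δ`, `F = 1` of `cost-link`, since the Δ-th power of a mass is a sum over
    -- Δ-tuples.
    cost-mass : ∀ α a′ m →
      Cost (Δ * (suc a′ * Δ * m)) (λ z → mass (restrict z α) ^ (Δ * (suc a′ * Δ * m)))
        (mass α ^ (Δ * (a′ * Δ * m)) * bip Δ α (suc a′) lam ^ (Δ * m))
    cost-mass α a′ m = cost-weaken
      (λ z → ≤-reflexive (trans (sym (^-*-assoc (mass (restrict z α)) Δ _)) (cong (_^ (suc a′ * Δ * m)) (total-mass (restrict z α) a′))))
      (≤-reflexive (cong (_* bip Δ α (suc a′) lam ^ (Δ * m))
        (trans (cong (_^ (a′ * Δ * m)) (sym (total-mass α (suc a′)))) (^-*-assoc (mass α) Δ _))))
      (cost-link α Δ 0 a′ (λ _ → 1) m refl)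
      where
      total-mass : ∀ γ k → mass γ ^ Δ ≡ ∑ (allMaps Δ q) (λ x → prodF Δ (λ i → γ (x i)) * 1 ^ k)
      total-mass γ k = trans (∑-^ Δ q γ) (∑-cong (allMaps Δ q) (λ x →
        sym (trans (cong (prodF Δ (λ i → γ (x i)) *_) (^-zeroˡ k)) (*-identityʳ _))))

-- Deleting a vertex

-- A guard whose default is neutral in products, as that of `_⇒⁰_` is in sums. Both bind more
-- tightly than `_*_` and `_+_`, and nest to the right.
_⇒¹_ : Bool → ℕ → ℕ
b ⇒¹ x = if b then x else 1

_⇒⁰_ : Bool → ℕ → ℕ
b ⇒⁰ x = if b then x else 0

infixr 8 _⇒¹_ _⇒⁰_

sumF-cong : ∀ k {f g : Fin k → ℕ} → (∀ i → f i ≡ g i) → sumF k f ≡ sumF k g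
sumF-cong zero    h = refl
sumF-cong (suc k) h = cong₂ _+_ (h zero) (sumF-cong k (λ i → h (suc i)))

sumF-mono : ∀ k {f g : Fin k → ℕ} → (∀ i → f i ≤ g i) → sumF k f ≤ sumF k g
sumF-mono zero    h = z≤n
sumF-mono (suc k) h = +-mono-≤ (h zero) (sumF-mono k (λ i → h (suc i)))

sumF-mono-< : ∀ k {f g : Fin k → ℕ} → (∀ i → f i ≤ g i) → ∀ j → f j < g j → sumF k f < sumF k g
sumF-mono-< (suc k) h zero    lt = +-mono-<-≤ lt (sumF-mono k (λ i → h (suc i)))
sumF-mono-< (suc k) h (suc j) lt = +-mono-≤-< (h zero) (sumF-mono-< k (λ i → h (suc i)) j lt)

sumF-zero : ∀ k → sumF k (λ _ → 0) ≡ 0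
sumF-zero zero    = refl
sumF-zero (suc k) = sumF-zero k

sumF-+ : ∀ k (f g : Fin k → ℕ) → sumF k (λ i → f i + g i) ≡ sumF k f + sumF k g
sumF-+ zero    f g = refl
sumF-+ (suc k) f g = trans (cong (f zero + g zero +_) (sumF-+ k _ _)) (e (f zero) (g zero) _ _)
  where
  e : ∀ a b c d → a + b + (c + d) ≡ a + c + (b + d)
  e = solve-∀

sumF-swap : ∀ k l (f : Fin k → Fin l → ℕ) →
  sumF k (λ i → sumF l (f i)) ≡ sumF l (λ j → sumF k (λ i → f i j))
sumF-swap zero    l f = sym (sumF-zero l)
sumF-swap (suc k) l f = trans (cong (sumF l (f zero) +_) (sumF-swap k l (λ i → f (suc i))))
                              (sym (sumF-+ l (f zero) _))

sumF-≥ : ∀ k (f : Fin k → ℕ) i → f i ≤ sumF k f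
sumF-≥ (suc k) f zero    = m≤m+n _ _
sumF-≥ (suc k) f (suc i) = ≤-trans (sumF-≥ k (λ i → f (suc i)) i) (m≤n+m _ _)

count : ∀ k → (Fin k → Bool) → ℕ
count k b = sumF k (λ i → b i ⇒⁰ 1)

sumF-count : ∀ k (b : Fin k → Bool) x → sumF k (λ i → b i ⇒⁰ x) ≡ count k b * x
sumF-count zero    b x = refl
sumF-count (suc k) b x with b zero
... | true  = cong (x +_) (sumF-count k (λ i → b (suc i)) x)
... | false = sumF-count k (λ i → b (suc i)) x

prodF-count : ∀ k (b : Fin k → Bool) x → prodF k (λ i → b i ⇒¹ x) ≡ x ^ count k b
prodF-count zero    b x = refl
prodF-count (suc k) b x with b zero
... | true  = cong (x *_) (prodF-count k (λ i → b (suc i)) x)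
... | false = trans (*-identityˡ _) (prodF-count k (λ i → b (suc i)) x)

⌊suc≟suc⌋ : ∀ {k} (i w : Fin k) → ⌊ suc i ≟ suc w ⌋ ≡ ⌊ i ≟ w ⌋
⌊suc≟suc⌋ i w with i ≟ w
... | yes _ = refl
... | no  _ = refl

sumF-select : ∀ k (w : Fin k) (f : Fin k → ℕ) → sumF k (λ i → ⌊ i ≟ w ⌋ ⇒⁰ f i) ≡ f w
sumF-select (suc k) zero    f = trans (cong (f zero +_) (sumF-zero k)) (+-identityʳ (f zero))
sumF-select (suc k) (suc w) f = trans (sumF-cong k (λ i → cong (_⇒⁰ f (suc i)) (⌊suc≟suc⌋ i w)))
                                      (sumF-select k w (λ i → f (suc i)))

prodF-select : ∀ k (w : Fin k) (f : Fin k → ℕ) → prodF k (λ i → ⌊ i ≟ w ⌋ ⇒¹ f i) ≡ f w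
prodF-select (suc k) zero    f = trans (cong (f zero *_) (prodF-one k)) (*-identityʳ (f zero))
prodF-select (suc k) (suc w) f = trans (*-identityˡ _) (trans
  (prodF-cong k (λ i → cong (_⇒¹ f (suc i)) (⌊suc≟suc⌋ i w))) (prodF-select k w (λ i → f (suc i))))

prodF-zero : ∀ k (f : Fin k → ℕ) i → f i ≡ 0 → prodF k f ≡ 0
prodF-zero (suc k) f zero    eq rewrite eq = refl
prodF-zero (suc k) f (suc i) eq = trans (cong (f zero *_) (prodF-zero k (λ i → f (suc i)) i eq)) (*-zeroʳ (f zero))

prodF-positive : ∀ k (f : Fin k → ℕ) → (∀ i → 0 < f i) → 0 < prodF k f
prodF-positive zero    f h = s≤s z≤n
prodF-positive (suc k) f h = *-mono-≤ (h zero) (prodF-positive k (λ i → f (suc i)) (λ i → h (suc i)))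

∑-allFin : ∀ q (f : Fin q → ℕ) → ∑ (allFin q) f ≡ sumF q f
∑-allFin q f = go q (λ i → i)
  where
  go : ∀ m (g : Fin m → Fin q) → ∑ (tabulate g) f ≡ sumF m (λ i → f (g i))
  go zero    g = refl
  go (suc m) g = cong (f (g zero) +_) (go m (λ i → g (suc i)))

argmax : ∀ k (f : Fin (suc k) → ℕ) → ∃ λ w → ∀ v → f v ≤ f w
argmax zero    f = zero , λ { zero → ≤-refl }
argmax (suc k) f with argmax k (λ i → f (suc i))
... | w , max with ≤-total (f zero) (f (suc w))
...   | inj₁ le = suc w , λ { zero → le ; (suc v) → max v }
...   | inj₂ ge = zero , λ { zero → ≤-refl ; (suc v) → ≤-trans (max v) ge }

module Removal {n : ℕ} (e : Fin n → Fin n → Bool) (e-sym : ∀ u v → e u v ≡ e v u)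
  (e-irrefl : ∀ v → e v v ≡ false) where

  deg : Fin n → ℕ
  deg v = count n (e v)

  module At (w : Fin n) where

    -- The vertex `w` is isolated rather than taken out, so that the vertex set keeps its indexing.
    removed : Fin n → Fin n → Bool
    removed u v = e u v ∧ not ⌊ u ≟ w ⌋ ∧ not ⌊ v ≟ w ⌋

    removed-sym : ∀ u v → removed u v ≡ removed v u
    removed-sym u v rewrite e-sym u v with e v u | ⌊ u ≟ w ⌋ | ⌊ v ≟ w ⌋
    ... | false | _     | _     = refl
    ... | true  | true  | true  = refl
    ... | true  | true  | false = refl
    ... | true  | false | true  = refl
    ... | true  | false | false = refl

    removed-irrefl : ∀ v → removed v v ≡ false
    removed-irrefl v rewrite e-irrefl v = refl

    removed-≢ˡ : ∀ u v → removed u v ≡ true → u ≢ w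
    removed-≢ˡ u v eq u≡w with e u v | u ≟ w
    removed-≢ˡ u v () u≡w | false | _
    removed-≢ˡ u v () u≡w | true | yes _
    ... | true | no u≢w = u≢w u≡w

    removed-wˡ : ∀ v → removed w v ≡ false
    removed-wˡ v with removed w v in eq
    ... | true  = ⊥-elim (removed-≢ˡ w v eq refl)
    ... | false = refl

    edge-split⁰ : ∀ v → v ≢ w → ∀ u → e v u ⇒⁰ 1 ≡ removed v u ⇒⁰ 1 + ⌊ u ≟ w ⌋ ⇒⁰ e w v ⇒⁰ 1
    edge-split⁰ v v≢w u with v ≟ w | u ≟ w
    ... | yes p | _ = ⊥-elim (v≢w p)
    ... | no _ | yes refl rewrite e-sym w v with e v w
    ...   | true  = refl
    ...   | false = refl
    edge-split⁰ v v≢w u | no _ | no _ with e v u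
    ...   | true  = refl
    ...   | false = refl

    edge-split¹ : ∀ (g : Fin n → Fin n → ℕ) u v →
      e u v ⇒¹ g u v ≡ removed u v ⇒¹ g u v * (⌊ u ≟ w ⌋ ⇒¹ e w v ⇒¹ g w v * ⌊ v ≟ w ⌋ ⇒¹ e w u ⇒¹ g u w)
    edge-split¹ g u v with u ≟ w | v ≟ w
    ... | yes refl | yes refl rewrite e-irrefl w = refl
    ... | yes refl | no _ with e w v
    ...   | true  = sym (trans (*-identityˡ _) (*-identityʳ _))
    ...   | false = refl
    edge-split¹ g u v | no _ | yes refl rewrite e-sym w u with e u w
    ...   | true  = sym (trans (*-identityˡ _) (*-identityˡ _))
    ...   | false = refl
    edge-split¹ g u v | no _ | no _ with e u v
    ...   | true  = sym (*-identityʳ _)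
    ...   | false = refl

    -- Products run over ordered pairs, so each edge at `w` is split off in both orientations.
    prodF-edges : ∀ (g : Fin n → Fin n → ℕ) →
      prodF n (λ u → prodF n (λ v → e u v ⇒¹ g u v))
        ≡ prodF n (λ u → prodF n (λ v → removed u v ⇒¹ g u v))
          * (prodF n (λ v → e w v ⇒¹ g w v) * prodF n (λ u → e w u ⇒¹ g u w))
    prodF-edges g = begin
      prodF n (λ u → prodF n (λ v → e u v ⇒¹ g u v))
        ≡⟨ prodF-cong n (λ u → trans (prodF-cong n (edge-split¹ g u)) (trans (prodF-* n _ _)
             (cong (prodF n (λ v → removed u v ⇒¹ g u v) *_) (trans (prodF-* n _ _)
               (cong₂ _*_ (constant-if ⌊ u ≟ w ⌋ (λ v → e w v ⇒¹ g w v)) (prodF-select n w (λ _ → e w u ⇒¹ g u w))))))) ⟩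
      prodF n (λ u → prodF n (λ v → removed u v ⇒¹ g u v) * (⌊ u ≟ w ⌋ ⇒¹ prodF n (λ v → e w v ⇒¹ g w v) * e w u ⇒¹ g u w))
        ≡⟨ trans (prodF-* n _ _) (cong (prodF n (λ u → prodF n (λ v → removed u v ⇒¹ g u v)) *_) (trans (prodF-* n _ _)
             (cong (_* prodF n (λ u → e w u ⇒¹ g u w)) (prodF-select n w (λ _ → prodF n (λ v → e w v ⇒¹ g w v)))))) ⟩
      prodF n (λ u → prodF n (λ v → removed u v ⇒¹ g u v))
        * (prodF n (λ v → e w v ⇒¹ g w v) * prodF n (λ u → e w u ⇒¹ g u w)) ∎
      where
      open ≡-Reasoning
      constant-if : ∀ b (f : Fin n → ℕ) → prodF n (λ v → b ⇒¹ f v) ≡ b ⇒¹ prodF n f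
      constant-if true  f = refl
      constant-if false f = prodF-one n

    deg′ : Fin n → ℕ
    deg′ v = count n (removed v)

    deg′-w : deg′ w ≡ 0
    deg′-w = trans (sumF-cong n (λ u → cong (_⇒⁰ 1) (removed-wˡ u))) (sumF-zero n)

    deg-split : ∀ v → v ≢ w → deg v ≡ deg′ v + e w v ⇒⁰ 1
    deg-split v v≢w = trans (sumF-cong n (edge-split⁰ v v≢w)) (trans (sumF-+ n _ _)
      (cong (deg′ v +_) (sumF-select n w (λ _ → e w v ⇒⁰ 1))))

    nbr-≢w : ∀ v → e w v ≡ true → v ≢ w
    nbr-≢w v eq refl with trans (sym eq) (e-irrefl w)
    ... | ()

    deg-nbr : ∀ v → e w v ≡ true → deg v ≡ suc (deg′ v)
    deg-nbr v eq = trans (deg-split v (nbr-≢w v eq)) (trans (cong (λ b → deg′ v + b ⇒⁰ 1) eq) (+-comm (deg′ v) 1))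

    deg′≤deg : ∀ v → deg′ v ≤ deg v
    deg′≤deg v = sumF-mono n λ u → le (e v u) _
      where
      le : ∀ a b → (a ∧ b) ⇒⁰ 1 ≤ a ⇒⁰ 1
      le false b     = z≤n
      le true  true  = ≤-refl
      le true  false = z≤n

    total-degree-decreases : 0 < deg w → sumF n deg′ < sumF n deg
    total-degree-decreases deg>0 = sumF-mono-< n deg′≤deg w (subst (_< deg w) (sym deg′-w) deg>0)

module Weighted (q : ℕ) (r : Fin q → Fin q → ℕ) (r-sym : ∀ x y → r x y ≡ r y x)
  (r-01 : ∀ x y → r x y ≡ 0 ⊎ r x y ≡ 1)
  (r-compat : ∀ z x y → r z x ≡ 1 → r z y ≡ 0 → r x y ≡ 1)
  (N K : ℕ) (inv : ℕ → ℕ) (inv-* : ∀ a → 0 < a → a ≤ N → a * inv a ≡ K) where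

  open Semiproper q r r-sym r-01 r-compat public

  -- Exponents are scaled by K⁴, so that inv a * inv b * K² stands for 1/(ab) and vertexExp stands for 2;
  -- the 2 is there because products over edges run over ordered pairs.
  edgeExp : ℕ → ℕ → ℕ
  edgeExp a b = inv a * inv b * (K * K)

  vertexExp : ℕ
  vertexExp = 2 * (K * K * (K * K))

  -- The scaled 1/a: normalising an edge factor to the power 1/(ab) divides it by |A|^(1/a)
  -- |B|^(1/b).
  massExp : ℕ → ℕ
  massExp a = K * K * K * inv a

  edgeFactor : ℕ → Weight → ℕ → Weight → ℕ
  edgeFactor a α b β = bip b α a β ^ edgeExp a b

  edgeFactor-sym : ∀ a α b β → edgeFactor a α b β ≡ edgeFactor b β a α
  edgeFactor-sym a α b β = cong₂ _^_ (bip-sym b α a β) (cong (_* (K * K)) (*-comm (inv a) (inv b)))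

  -- Deleting a vertex may isolate its neighbours, so the induction needs a bound for graphs with
  -- isolated vertices, each of which contributes its mass.
  isolatedFactor : ℕ → ℕ → ℕ
  isolatedFactor zero    m = m ^ vertexExp
  isolatedFactor (suc _) m = 1

  edgeFactor-restrict-both : ∀ a b z α β → 0 < a → 0 < b → suc a ≤ N → suc b ≤ N →
    mass β ^ massExp (suc b) * edgeFactor a (restrict z α) b (restrict z β)
      ≤ edgeFactor a (restrict z α) (suc b) β * mass (restrict z β) ^ massExp b
  edgeFactor-restrict-both a b z α β a>0 b>0 a<N b<N = begin
    M ^ massExp (suc b) * N₁ ^ edgeExp a b
      ≡⟨ cong₂ (λ s t → M ^ s * N₁ ^ t)
           (trans (cong₂ (λ s t → s * t * K * ib′) (sym A) (sym B)) (x₁ a b ia ib ib′ K))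
           (trans (cong (λ s → ia * ib * (s * K)) (sym B′)) (x₂ ia ib (suc b) ib′ K)) ⟩
    M ^ (a * b * t) * N₁ ^ (suc b * t)     ≡⟨ cong₂ _*_ (^-*-assoc M (a * b) t) (^-*-assoc N₁ (suc b) t) ⟨
    (M ^ (a * b)) ^ t * (N₁ ^ suc b) ^ t   ≡⟨ *-^-distrib (M ^ (a * b)) (N₁ ^ suc b) t ⟨
    (M ^ (a * b) * N₁ ^ suc b) ^ t         ≡⟨ cong (_^ t) (*-comm (M ^ (a * b)) _) ⟩
    (N₁ ^ suc b * M ^ (a * b)) ^ t         ≤⟨ ^-monoˡ-≤ t (bip-restrict-both b a z α β) ⟩
    (N₃ ^ b * m ^ (a * suc b)) ^ t         ≡⟨ *-^-distrib (N₃ ^ b) (m ^ (a * suc b)) t ⟩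
    (N₃ ^ b) ^ t * (m ^ (a * suc b)) ^ t   ≡⟨ cong₂ _*_ (^-*-assoc N₃ b t) (^-*-assoc m (a * suc b) t) ⟩
    N₃ ^ (b * t) * m ^ (a * suc b * t)
      ≡⟨ cong₂ (λ s t → N₃ ^ s * m ^ t)
           (trans (cong (λ s → ia * ib′ * (s * K)) (sym B)) (x₃ ia ib b ib′ K))
           (trans (cong₂ (λ s t → s * t * K * ib) (sym A) (sym B′)) (x₄ a (suc b) ia ib ib′ K)) ⟨
    N₃ ^ edgeExp a (suc b) * m ^ massExp b ∎
    where
    open ≤-Reasoning
    M = mass β
    m = mass (restrict z β)
    N₁ = bip b (restrict z α) a (restrict z β)
    N₃ = bip (suc b) (restrict z α) a β
    ia = inv a
    ib = inv b
    ib′ = inv (suc b)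
    -- The scaled 1/(a b (b + 1)), the power to which `bip-restrict-both` must be raised.
    t = ia * ib * ib′ * K
    A : a * ia ≡ K
    A = inv-* a a>0 (≤-trans (n≤1+n a) a<N)
    B : b * ib ≡ K
    B = inv-* b b>0 (≤-trans (n≤1+n b) b<N)
    B′ : suc b * ib′ ≡ K
    B′ = inv-* (suc b) (s≤s z≤n) b<N
    x₁ : ∀ a b ia ib ib′ K → a * ia * (b * ib) * K * ib′ ≡ a * b * (ia * ib * ib′ * K)
    x₁ = solve-∀
    x₂ : ∀ ia ib b′ ib′ K → ia * ib * (b′ * ib′ * K) ≡ b′ * (ia * ib * ib′ * K)
    x₂ = solve-∀
    x₃ : ∀ ia ib b ib′ K → ia * ib′ * (b * ib * K) ≡ b * (ia * ib * ib′ * K)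
    x₃ = solve-∀
    x₄ : ∀ a b′ ia ib ib′ K → a * ia * (b′ * ib′) * K * ib ≡ a * b′ * (ia * ib * ib′ * K)
    x₄ = solve-∀

  module Steps (lam μ : Weight) (Δ : ℕ) (Δ>0 : 0 < Δ) (Δ≤N : Δ ≤ N) where
    open LinkCosts lam μ Δ public

    -- The scaled 1/(a (a + 1) Δ). The `a` remaining edges at a neighbour of degree `suc a` together
    -- contribute 1/((a + 1) Δ), the exponent of the deleted edge.
    linkExp : ℕ → ℕ
    linkExp a = K * inv a * inv (suc a) * inv Δ

    centre : ℕ → Weight → ℕ
    centre a α = bip Δ α a lam

    private
      D : Δ * inv Δ ≡ K
      D = inv-* Δ Δ>0 Δ≤N

    -- For an edge with exactly one end adjacent to `w`: that end has its degree lowered from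
    -- `suc a` to `a` and its weight restricted.
    cost-edge : ∀ a b α β → 0 < a → suc a ≤ N → 0 < b → b ≤ Δ →
      Cost (massExp a) (λ z → edgeFactor a (restrict z α) b β)
           (edgeFactor (suc a) α b β * centre (suc a) α ^ linkExp a)
    cost-edge a b α β a>0 a<N b>0 b≤Δ = cost-resp-≡ k-eq (cost-weaken
        (λ z → ≤-reflexive (cong (bip b (restrict z α) a β ^_) (sym h-eq)))
        (≤-reflexive (cong₂ (λ s t → bip b α (suc a) β ^ s * centre (suc a) α ^ t) R-eq x-eq))
        (cost-bip α b a β m b≤Δ))
      where
      ia = inv a
      ia′ = inv (suc a)
      ib = inv b
      -- Makes `suc a * Δ * m` equal to `edgeExp a b` and `a * Δ * m` equal to `edgeExp (suc a) b`.
      m = ia * ib * ia′ * inv Δ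
      A : a * ia ≡ K
      A = inv-* a a>0 (≤-trans (n≤1+n a) a<N)
      A′ : suc a * ia′ ≡ K
      A′ = inv-* (suc a) (s≤s z≤n) a<N
      B : b * ib ≡ K
      B = inv-* b b>0 (≤-trans b≤Δ Δ≤N)
      x₁ : ∀ a d ia ib ia′ id → a * d * (ia * ib * ia′ * id) ≡ ia * ib * (a * ia′ * (d * id))
      x₁ = solve-∀
      x₂ : ∀ a d ia ib ia′ id → a * d * (ia * ib * ia′ * id) ≡ ia′ * ib * (a * ia * (d * id))
      x₂ = solve-∀
      x₃ : ∀ b ia ib ia′ id → b * (ia * ib * ia′ * id) ≡ b * ib * ia * ia′ * id
      x₃ = solve-∀
      x₄ : ∀ b ia ib K → b * (ia * ib * (K * K)) ≡ b * ib * K * K * ia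
      x₄ = solve-∀
      h-eq : suc a * Δ * m ≡ edgeExp a b
      h-eq = trans (x₁ (suc a) Δ ia ib ia′ (inv Δ)) (cong₂ (λ s t → ia * ib * (s * t)) A′ D)
      R-eq : a * Δ * m ≡ edgeExp (suc a) b
      R-eq = trans (x₂ a Δ ia ib ia′ (inv Δ)) (cong₂ (λ s t → ia′ * ib * (s * t)) A D)
      x-eq : b * m ≡ linkExp a
      x-eq = trans (x₃ b ia ib ia′ (inv Δ)) (cong (λ s → s * ia * ia′ * inv Δ) B)
      k-eq : b * (suc a * Δ * m) ≡ massExp a
      k-eq = trans (cong (b *_) h-eq) (trans (x₄ b ia ib K) (cong (λ s → s * K * K * ia) B))

    -- The exponent of `μ` and the power of `centre` agree with those of `cost-edge`, so a
    -- restricted mass is charged to its vertex exactly as an edge would be.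
    cost-restricted-mass : ∀ a α → 0 < a → suc a ≤ N →
      Cost (massExp a) (λ z → mass (restrict z α) ^ massExp a)
           (mass α ^ massExp (suc a) * centre (suc a) α ^ linkExp a)
    cost-restricted-mass a α a>0 a<N = cost-resp-≡ k-eq (cost-weaken
        (λ z → ≤-reflexive (cong (mass (restrict z α) ^_) (sym k-eq)))
        (≤-reflexive (cong₂ (λ s t → mass α ^ s * centre (suc a) α ^ t) R-eq x-eq))
        (cost-mass α a m))
      where
      ia = inv a
      ia′ = inv (suc a)
      id = inv Δ
      m = ia * ia′ * (id * id)
      A : a * ia ≡ K
      A = inv-* a a>0 (≤-trans (n≤1+n a) a<N)
      A′ : suc a * ia′ ≡ K
      A′ = inv-* (suc a) (s≤s z≤n) a<N
      x₁ : ∀ a d ia ia′ id → d * (a * d * (ia * ia′ * (id * id))) ≡ d * id * (d * id) * (a * ia′) * ia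
      x₁ = solve-∀
      x₂ : ∀ a d ia ia′ id → d * (a * d * (ia * ia′ * (id * id))) ≡ d * id * (d * id) * (a * ia) * ia′
      x₂ = solve-∀
      x₃ : ∀ d ia ia′ id → d * (ia * ia′ * (id * id)) ≡ d * id * ia * ia′ * id
      x₃ = solve-∀
      k-eq : Δ * (suc a * Δ * m) ≡ massExp a
      k-eq = trans (x₁ (suc a) Δ ia ia′ id) (cong₂ (λ s t → s * s * t * ia) D A′)
      R-eq : Δ * (a * Δ * m) ≡ massExp (suc a)
      R-eq = trans (x₂ a Δ ia ia′ id) (cong₂ (λ s t → s * s * t * ia′) D A)
      x-eq : Δ * m ≡ linkExp a
      x-eq = trans (x₃ Δ ia ia′ id) (cong (λ s → s * ia * ia′ * id) D)

    -- `edgeFactor-restrict-both` leaves two factors with one restriction each, charged to the two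
    -- ends separately. The power of `mass β` does not depend on `z`; it stays on both sides in
    -- place of a division.
    cost-triangle : ∀ a b α β → 0 < a → suc a ≤ N → 0 < b → suc b ≤ Δ →
      Cost (massExp a + massExp b)
        (λ z → mass β ^ massExp (suc b) * edgeFactor a (restrict z α) b (restrict z β))
        (mass β ^ massExp (suc b) * edgeFactor (suc a) α (suc b) β
          * (centre (suc a) α ^ linkExp a * centre (suc b) β ^ linkExp b))
    cost-triangle a b α β a>0 a<N b>0 b<Δ = cost-weaken
      (λ z → edgeFactor-restrict-both a b z α β a>0 b>0 a<N (≤-trans b<Δ Δ≤N))
      (≤-reflexive (shuffle (edgeFactor (suc a) α (suc b) β) (centre (suc a) α ^ linkExp a) (mass β ^ massExp (suc b)) (centre (suc b) β ^ linkExp b)))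
      (cost-* (cost-edge a (suc b) α β a>0 a<N (s≤s z≤n) b<Δ)
              (cost-restricted-mass b β b>0 (≤-trans b<Δ Δ≤N)))
      where
      shuffle : ∀ x y z w → x * y * (z * w) ≡ z * x * (y * w)
      shuffle = solve-∀

    -- A neighbour of degree 1 becomes isolated, and its whole budget goes to its mass. The factor 2
    -- accounts for both orientations of the deleted edge.
    cost-leaf : ∀ α → Cost vertexExp (λ z → mass (restrict z α) ^ vertexExp) (centre 1 α ^ (2 * edgeExp 1 Δ))
    cost-leaf α = cost-resp-≡ k-eq (cost-weaken
        (λ z → ≤-reflexive (cong (mass (restrict z α) ^_) (sym k-eq)))
        (≤-reflexive (trans (cong (λ s → mass α ^ s * centre 1 α ^ (Δ * m)) (*-zeroʳ Δ)) (trans (*-identityˡ _) (cong (centre 1 α ^_) x-eq))))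
        (cost-mass α 0 m))
      where
      id = inv Δ
      m = 2 * (K * K * (id * id))
      I₁ : inv 1 ≡ K
      I₁ = trans (sym (*-identityˡ (inv 1))) (inv-* 1 (s≤s z≤n) (≤-trans Δ>0 Δ≤N))
      x₁ : ∀ d id K → d * (1 * d * (2 * (K * K * (id * id)))) ≡ 2 * (K * K * (d * id * (d * id)))
      x₁ = solve-∀
      x₂ : ∀ d id K → d * (2 * (K * K * (id * id))) ≡ 2 * (d * id * id * (K * K))
      x₂ = solve-∀
      k-eq : Δ * (1 * Δ * m) ≡ vertexExp
      k-eq = trans (x₁ Δ id K) (cong (λ s → 2 * (K * K * (s * s))) D)
      x-eq : Δ * m ≡ 2 * edgeExp 1 Δ
      x-eq = trans (x₂ Δ id K) (trans (cong (λ s → 2 * (s * id * (K * K))) (trans D (sym I₁))) refl)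

-- Induction on the graph

module Induction (q : ℕ) (r : Fin q → Fin q → ℕ) (r-sym : ∀ x y → r x y ≡ r y x)
  (r-01 : ∀ x y → r x y ≡ 0 ⊎ r x y ≡ 1)
  (r-compat : ∀ z x y → r z x ≡ 1 → r z y ≡ 0 → r x y ≡ 1)
  (N K : ℕ) (K>0 : 0 < K) (inv : ℕ → ℕ) (inv-* : ∀ a → 0 < a → a ≤ N → a * inv a ≡ K) where

  open Weighted q r r-sym r-01 r-compat N K inv inv-* public

  -- Taking each edge in both orientations is harmless because `r` has values 0 and 1.
  hom : ∀ {n} → (Fin n → Fin n → Bool) → (Fin n → Weight) → ℕ
  hom {n} e lam = ∑ (allMaps n q) (λ φ →
    prodF n (λ v → lam v (φ v)) * prodF n (λ u → prodF n (λ v → e u v ⇒¹ r (φ u) (φ v))))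

  bound : ∀ {n} → (Fin n → Fin n → Bool) → (Fin n → Weight) → ℕ
  bound {n} e lam = prodF n (λ v → isolatedFactor (count n (e v)) (mass (lam v)))
    * prodF n (λ u → prodF n (λ v → e u v ⇒¹ edgeFactor (count n (e u)) (lam u) (count n (e v)) (lam v)))

  point : Fin q → Weight
  point z c = ⌊ c ≟ z ⌋ ⇒⁰ 1

  mass-point : ∀ z → mass (point z) ≡ 1
  mass-point z = trans (∑-allFin q (point z)) (sumF-select q z (λ _ → 1))

  vertexExp>0 : 0 < vertexExp
  vertexExp>0 = *-mono-≤ {1} {2} (s≤s z≤n) (*-mono-≤ (*-mono-≤ K>0 K>0) (*-mono-≤ K>0 K>0))

  hom≤masses : ∀ {n} e (lam : Fin n → Weight) → hom e lam ≤ prodF n (λ v → mass (lam v))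
  hom≤masses {n} e lam = ≤-trans
    (∑-mono (allMaps n q) (λ φ → ≤-trans (*-monoʳ-≤ (prodF n (λ v → lam v (φ v))) (edges≤1 φ)) (≤-reflexive (*-identityʳ _))))
    (≤-reflexive (∑-allMaps-prodF n q lam))
    where
    ⇒¹≤1 : ∀ b {x} → x ≤ 1 → b ⇒¹ x ≤ 1
    ⇒¹≤1 true  x≤1 = x≤1
    ⇒¹≤1 false x≤1 = ≤-refl
    edges≤1 : ∀ φ → prodF n (λ u → prodF n (λ v → e u v ⇒¹ r (φ u) (φ v))) ≤ 1
    edges≤1 φ = ≤-trans (prodF-mono n (λ u → ≤-trans (prodF-mono n (λ v → ⇒¹≤1 (e u v) (r≤1 (φ u) (φ v)))) (≤-reflexive (prodF-one n))))
                        (≤-reflexive (prodF-one n))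

  module VertexStep {n : ℕ} (e : Fin n → Fin n → Bool) (e-sym : ∀ u v → e u v ≡ e v u)
    (e-irrefl : ∀ v → e v v ≡ false) (lam : Fin n → Weight) (w : Fin n)
    (deg≤N : ∀ v → Removal.deg e e-sym e-irrefl v ≤ N)
    (deg-max : ∀ v → Removal.deg e e-sym e-irrefl v ≤ Removal.deg e e-sym e-irrefl w)
    (deg>0 : 0 < Removal.deg e e-sym e-irrefl w) where

    open Removal e e-sym e-irrefl
    open At w

    Δ : ℕ
    Δ = deg w

    -- The isolated vertex `w` keeps a point mass at its colour: its mass is 1, so it contributes
    -- nothing to the bound.
    residual : Fin q → Fin n → Weight
    residual z v = if ⌊ v ≟ w ⌋ then point z else (if e w v then restrict z (lam v) else lam v)

    residual-w : ∀ z → residual z w ≡ point z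
    residual-w z with w ≟ w
    ... | yes _  = refl
    ... | no w≢w = ⊥-elim (w≢w refl)

    residual-other : ∀ z v → v ≢ w → residual z v ≡ (if e w v then restrict z (lam v) else lam v)
    residual-other z v v≢w with v ≟ w
    ... | yes v≡w = ⊥-elim (v≢w v≡w)
    ... | no _    = refl

    -- The constant by which `cost-triangle` multiplies both sides, present only for edges inside
    -- the neighbourhood of `w`.
    pairConst : Fin n → Fin n → ℕ
    pairConst u v = removed u v ⇒¹ e w u ⇒¹ e w v ⇒¹ mass (lam v) ^ massExp (deg v)

    target : Fin n → Fin n → ℕ
    target u v = edgeFactor (deg u) (lam u) (deg v) (lam v)

    total-constant : ℕ
    total-constant = prodF n (λ u → prodF n (pairConst u))

    module Certificates (μ : Weight) where
      open Steps (lam w) μ Δ deg>0 (deg≤N w)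

      linkFactor : Fin n → ℕ
      linkFactor v = centre (deg v) (lam v) ^ linkExp (deg′ v)

      -- The cases are: not an edge, and an edge with neither, one or both ends adjacent to `w`.
      -- Degrees are variables so that matching can replace them by successors. The equations are
      -- assumed only for edges, since they may fail when an end is `w`.
      cost-pair : ∀ b pu pv (du du′ dv dv′ : ℕ) (α β : Weight) (αz βz : Fin q → Weight) →
        (b ≡ true → 0 < du′) → (b ≡ true → 0 < dv′) → du ≤ Δ → dv ≤ Δ →
        (b ≡ true → du ≡ du′ + pu ⇒⁰ 1) → (b ≡ true → dv ≡ dv′ + pv ⇒⁰ 1) →
        (b ≡ true → ∀ z → αz z ≡ (if pu then restrict z α else α)) →
        (b ≡ true → ∀ z → βz z ≡ (if pv then restrict z β else β)) →
        Cost (b ⇒⁰ pu ⇒⁰ massExp du′ + b ⇒⁰ pv ⇒⁰ massExp dv′)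
          (λ z → b ⇒¹ pu ⇒¹ pv ⇒¹ mass β ^ massExp dv * b ⇒¹ edgeFactor du′ (αz z) dv′ (βz z))
          (b ⇒¹ pu ⇒¹ pv ⇒¹ mass β ^ massExp dv * b ⇒¹ edgeFactor du α dv β
            * (b ⇒¹ pu ⇒¹ centre du α ^ linkExp du′ * b ⇒¹ pv ⇒¹ centre dv β ^ linkExp dv′))
      cost-pair false pu pv du du′ dv dv′ α β αz βz _ _ _ _ _ _ _ _ = cost-const 1
      cost-pair true false false du du′ dv dv′ α β αz βz _ _ _ _ eu ev eα eβ = cost-weaken
        (λ z → ≤-reflexive (trans (*-identityˡ _) (trans
          (cong₂ (λ s t → edgeFactor s (αz z) t (βz z)) (sym (trans (eu refl) (+-identityʳ du′))) (sym (trans (ev refl) (+-identityʳ dv′))))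
          (cong₂ (λ s t → edgeFactor du s dv t) (eα refl z) (eβ refl z)))))
        (≤-reflexive (sym (trans (*-identityʳ _) (*-identityˡ _))))
        (cost-const (edgeFactor du α dv β))
      cost-pair true true false du du′ dv dv′ α β αz βz du′>0 dv′>0 du≤Δ dv≤Δ eu ev eα eβ
        with du | trans (eu refl) (+-comm du′ 1) | dv | trans (ev refl) (+-identityʳ dv′)
      ... | _ | refl | _ | refl = cost-resp-≡ (sym (+-identityʳ _)) (cost-weaken
        (λ z → ≤-reflexive (trans (*-identityˡ _) (cong₂ (λ s t → edgeFactor du′ s dv′ t) (eα refl z) (eβ refl z))))
        (≤-reflexive (cong₂ _*_ (sym (*-identityˡ (edgeFactor (suc du′) α dv′ β))) (sym (*-identityʳ _))))
        (cost-edge du′ dv′ α β (du′>0 refl) (≤-trans du≤Δ (deg≤N w)) (dv′>0 refl) dv≤Δ))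
      cost-pair true false true du du′ dv dv′ α β αz βz du′>0 dv′>0 du≤Δ dv≤Δ eu ev eα eβ
        with du | trans (eu refl) (+-identityʳ du′) | dv | trans (ev refl) (+-comm dv′ 1)
      ... | _ | refl | _ | refl = cost-weaken
        (λ z → ≤-reflexive (trans (*-identityˡ _) (trans (cong₂ (λ s t → edgeFactor du′ s dv′ t) (eα refl z) (eβ refl z))
          (edgeFactor-sym du′ α dv′ (restrict z β)))))
        (≤-reflexive (cong₂ _*_ (trans (edgeFactor-sym (suc dv′) β du′ α) (sym (*-identityˡ _))) (sym (*-identityˡ _))))
        (cost-edge dv′ du′ β α (dv′>0 refl) (≤-trans dv≤Δ (deg≤N w)) (du′>0 refl) du≤Δ)
      cost-pair true true true du du′ dv dv′ α β αz βz du′>0 dv′>0 du≤Δ dv≤Δ eu ev eα eβ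
        with du | trans (eu refl) (+-comm du′ 1) | dv | trans (ev refl) (+-comm dv′ 1)
      ... | _ | refl | _ | refl = cost-weaken
        (λ z → ≤-reflexive (cong₂ (λ s t → mass β ^ massExp (suc dv′) * edgeFactor du′ s dv′ t) (eα refl z) (eβ refl z)))
        ≤-refl
        (cost-triangle du′ dv′ α β (du′>0 refl) (≤-trans du≤Δ (deg≤N w)) (dv′>0 refl) dv≤Δ)

      leafExp : ℕ → ℕ
      leafExp zero    = vertexExp
      leafExp (suc _) = 0

      leafFactor : ℕ → ℕ → ℕ
      leafFactor zero    y = y
      leafFactor (suc _) y = 1

      -- Only neighbours of `w` that become isolated have a cost: other vertices keep a constant
      -- factor, and `w` has mass 1.
      cost-vertex : ∀ v →
        Cost (e w v ⇒⁰ leafExp (deg′ v)) (λ z → isolatedFactor (deg′ v) (mass (residual z v)))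
          (isolatedFactor (deg v) (mass (lam v)) * e w v ⇒¹ leafFactor (deg′ v) (centre (deg v) (lam v) ^ (2 * edgeExp (deg v) Δ)))
      cost-vertex v = split (v ≟ w)
        where
        isolated-one : ∀ d → isolatedFactor d 1 ≡ 1
        isolated-one zero    = ^-zeroˡ vertexExp
        isolated-one (suc d) = refl
        isolated-positive : ∀ {d m} → 0 < d → isolatedFactor d m ≡ 1
        isolated-positive (s≤s _) = refl
        go : ∀ b d d′ → d ≡ d′ + b ⇒⁰ 1 →
          Cost (b ⇒⁰ leafExp d′) (λ z → isolatedFactor d′ (mass (if b then restrict z (lam v) else lam v)))
            (isolatedFactor d (mass (lam v)) * b ⇒¹ leafFactor d′ (centre d (lam v) ^ (2 * edgeExp d Δ)))
        go false d d′ eq with d | trans eq (+-identityʳ d′)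
        ... | _ | refl = cost-weaken (λ z → ≤-refl) (≤-reflexive (sym (*-identityʳ _))) (cost-const (isolatedFactor d′ (mass (lam v))))
        go true d d′ eq with d | trans eq (+-comm d′ 1)
        go true d zero     eq | _ | refl = cost-weaken (λ z → ≤-refl) (≤-reflexive (sym (*-identityˡ _))) (cost-leaf (lam v))
        go true d (suc d′) eq | _ | refl = cost-const 1
        split : Dec (v ≡ w) → Cost (e w v ⇒⁰ leafExp (deg′ v)) (λ z → isolatedFactor (deg′ v) (mass (residual z v)))
          (isolatedFactor (deg v) (mass (lam v)) * e w v ⇒¹ leafFactor (deg′ v) (centre (deg v) (lam v) ^ (2 * edgeExp (deg v) Δ)))
        split (no v≢w) = cost-weaken
          (λ z → ≤-reflexive (cong (λ s → isolatedFactor (deg′ v) (mass s)) (residual-other z v v≢w)))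
          ≤-refl
          (go (e w v) (deg v) (deg′ v) (deg-split v v≢w))
        split (yes refl) = cost-resp-≡ (sym (cong (_⇒⁰ leafExp (deg′ w)) (e-irrefl w))) (cost-weaken
          (λ z → ≤-reflexive (trans (cong (isolatedFactor (deg′ w)) (trans (cong mass (residual-w z)) (mass-point z))) (isolated-one (deg′ w))))
          (≤-reflexive (sym (cong₂ _*_ (isolated-positive deg>0) (cong (_⇒¹ leafFactor (deg′ w) (centre (deg w) (lam w) ^ (2 * edgeExp (deg w) Δ))) (e-irrefl w)))))
          (cost-const 1))

      removed-positive : ∀ u v → removed u v ≡ true → 0 < deg′ u
      removed-positive u v eq = ≤-trans (≤-reflexive (sym (cong (_⇒⁰ 1) eq))) (sumF-≥ n (λ x → removed u x ⇒⁰ 1) v)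

      removed-≢ʳ : ∀ u v → removed u v ≡ true → v ≢ w
      removed-≢ʳ u v eq = removed-≢ˡ v u (trans (removed-sym v u) eq)

      cost-edges : ∀ u v →
        Cost (removed u v ⇒⁰ e w u ⇒⁰ massExp (deg′ u) + removed u v ⇒⁰ e w v ⇒⁰ massExp (deg′ v))
          (λ z → pairConst u v * removed u v ⇒¹ edgeFactor (deg′ u) (residual z u) (deg′ v) (residual z v))
          (pairConst u v * removed u v ⇒¹ target u v
            * (removed u v ⇒¹ e w u ⇒¹ linkFactor u * removed u v ⇒¹ e w v ⇒¹ linkFactor v))
      cost-edges u v = cost-pair (removed u v) (e w u) (e w v) (deg u) (deg′ u) (deg v) (deg′ v) (lam u) (lam v)
        (λ z → residual z u) (λ z → residual z v)
        (removed-positive u v) (λ eq → removed-positive v u (trans (removed-sym v u) eq))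
        (deg-max u) (deg-max v)
        (λ eq → deg-split u (removed-≢ˡ u v eq)) (λ eq → deg-split v (removed-≢ʳ u v eq))
        (λ eq z → residual-other z u (removed-≢ˡ u v eq)) (λ eq z → residual-other z v (removed-≢ʳ u v eq))

      deg′≤N : ∀ v → deg′ v ≤ N
      deg′≤N v = ≤-trans (deg′≤deg v) (deg≤N v)

      -- Each neighbour `v` of `w` uses up exactly `vertexExp`: either as a leaf, or as `deg′ v`
      -- edges in two orientations at a scaled 1/`deg′ v` each. There are `Δ` neighbours.
      total-exponent :
        sumF n (λ v → e w v ⇒⁰ leafExp (deg′ v))
          + sumF n (λ u → sumF n (λ v → removed u v ⇒⁰ e w u ⇒⁰ massExp (deg′ u) + removed u v ⇒⁰ e w v ⇒⁰ massExp (deg′ v)))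
        ≡ vertexExp * Δ
      total-exponent = begin
        L + sumF n (λ u → sumF n (λ v → removed u v ⇒⁰ x u + removed u v ⇒⁰ x v))
          ≡⟨ cong (L +_) (trans (sumF-cong n (λ u → sumF-+ n _ _)) (sumF-+ n _ _)) ⟩
        L + (sumF n (λ u → sumF n (λ v → removed u v ⇒⁰ x u)) + sumF n (λ u → sumF n (λ v → removed u v ⇒⁰ x v)))
          ≡⟨ cong₂ (λ s t → L + (s + t)) (sumF-cong n (λ u → sumF-count n (removed u) (x u)))
               (trans (sumF-swap n n _) (sumF-cong n (λ v → trans
                 (sumF-cong n (λ u → cong (_⇒⁰ x v) (removed-sym u v))) (sumF-count n (removed v) (x v))))) ⟩
        L + (sumF n (λ v → deg′ v * x v) + sumF n (λ v → deg′ v * x v))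
          ≡⟨ cong (L +_) (sumF-+ n _ _) ⟨
        L + sumF n (λ v → deg′ v * x v + deg′ v * x v)
          ≡⟨ sumF-+ n _ _ ⟨
        sumF n (λ v → e w v ⇒⁰ leafExp (deg′ v) + (deg′ v * x v + deg′ v * x v))
          ≡⟨ sumF-cong n (λ v → at-vertex (e w v) (deg′ v) (deg′≤N v)) ⟩
        sumF n (λ v → e w v ⇒⁰ vertexExp)
          ≡⟨ sumF-count n (e w) vertexExp ⟩
        Δ * vertexExp
          ≡⟨ *-comm Δ vertexExp ⟩
        vertexExp * Δ ∎
        where
        open ≡-Reasoning
        L = sumF n (λ v → e w v ⇒⁰ leafExp (deg′ v))
        x : Fin n → ℕ
        x v = e w v ⇒⁰ massExp (deg′ v)
        s₁ : ∀ d i K → d * (K * K * K * i) + d * (K * K * K * i) ≡ 2 * (K * K * (K * (d * i)))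
        s₁ = solve-∀
        at-vertex : ∀ b d → d ≤ N → b ⇒⁰ leafExp d + (d * (b ⇒⁰ massExp d) + d * (b ⇒⁰ massExp d)) ≡ b ⇒⁰ vertexExp
        at-vertex false d       d≤N rewrite *-zeroʳ d = refl
        at-vertex true  zero    d≤N = +-identityʳ vertexExp
        at-vertex true  (suc d) d≤N = trans (s₁ (suc d) (inv (suc d)) K)
          (cong (λ s → 2 * (K * K * (K * s))) (inv-* (suc d) (s≤s z≤n) d≤N))

      centreFactor : Fin n → ℕ
      centreFactor v = centre (deg v) (lam v) ^ edgeExp (deg v) Δ

      -- The powers of `centre` collected at a neighbour amount to the two oriented copies of its
      -- deleted edge; a leaf supplies both at once.
      vertex-product : ∀ b d d′ α → (b ≡ true → d ≡ suc d′) → d ≤ N →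
        b ⇒¹ leafFactor d′ (centre d α ^ (2 * edgeExp d Δ))
          * ((b ⇒¹ centre d α ^ linkExp d′) ^ d′ * (b ⇒¹ centre d α ^ linkExp d′) ^ d′)
        ≡ b ⇒¹ centre d α ^ edgeExp d Δ * b ⇒¹ centre d α ^ edgeExp d Δ
      vertex-product false d d′ α eq d≤N rewrite ^-zeroˡ d′ = refl
      vertex-product true d d′ α eq d≤N with d | eq refl
      vertex-product true d zero α eq d≤N | _ | refl = trans (*-identityʳ _)
        (trans (cong (centre 1 α ^_) (cong (edgeExp 1 Δ +_) (+-identityʳ _))) (^-distribˡ-+-* (centre 1 α) (edgeExp 1 Δ) (edgeExp 1 Δ)))
      vertex-product true d (suc d″) α eq d≤N | _ | refl = trans (*-identityˡ _) (cong (λ s → s * s)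
        (trans (^-*-assoc (centre (suc d′) α) (linkExp d′) d′) (cong (centre (suc d′) α ^_) exp-eq)))
        where
        d′ = suc d″
        s₁ : ∀ K i i′ j d → K * i * i′ * j * d ≡ i′ * j * (K * (d * i))
        s₁ = solve-∀
        exp-eq : linkExp d′ * d′ ≡ edgeExp (suc d′) Δ
        exp-eq = trans (s₁ K (inv d′) (inv (suc d′)) (inv Δ) d′)
          (cong (λ s → inv (suc d′) * inv Δ * (K * s)) (inv-* d′ (s≤s z≤n) (≤-trans (n≤1+n d′) d≤N)))

      -- The factors of the remaining edges already have their original degrees and weights, and
      -- `vertex-product` restores the edges at `w`.
      total-product :
        prodF n (λ v → isolatedFactor (deg v) (mass (lam v)) * e w v ⇒¹ leafFactor (deg′ v) (centre (deg v) (lam v) ^ (2 * edgeExp (deg v) Δ)))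
          * prodF n (λ u → prodF n (λ v → pairConst u v * removed u v ⇒¹ target u v
              * (removed u v ⇒¹ e w u ⇒¹ linkFactor u * removed u v ⇒¹ e w v ⇒¹ linkFactor v)))
        ≡ total-constant * bound e lam
      total-product = begin
        prodF n (λ v → iso v * leaf v) * prodF n (λ u → prodF n (λ v → pairConst u v * removed u v ⇒¹ target u v
              * (removed u v ⇒¹ y u * removed u v ⇒¹ y v)))
          ≡⟨ cong₂ _*_ (prodF-* n iso leaf) (trans
               (prodF-cong n (λ u → trans (prodF-* n _ _) (cong₂ _*_ (prodF-* n _ _) (prodF-* n _ _))))
               (trans (prodF-* n _ _) (cong₂ _*_ (prodF-* n _ _) (prodF-* n _ _)))) ⟩
        I * prodF n leaf * (total-constant * M * (prodF n (λ u → prodF n (λ v → removed u v ⇒¹ y u)) * prodF n (λ u → prodF n (λ v → removed u v ⇒¹ y v))))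
          ≡⟨ cong₂ (λ s t → I * prodF n leaf * (total-constant * M * (s * t)))
               (prodF-cong n (λ u → prodF-count n (removed u) (y u)))
               (trans (prodF-swap n n _) (prodF-cong n (λ v → trans
                 (prodF-cong n (λ u → cong (_⇒¹ y v) (removed-sym u v))) (prodF-count n (removed v) (y v))))) ⟩
        I * prodF n leaf * (total-constant * M * (prodF n (λ v → y v ^ deg′ v) * prodF n (λ v → y v ^ deg′ v)))
          ≡⟨ s₁ I (prodF n leaf) total-constant M (prodF n (λ v → y v ^ deg′ v)) ⟩
        total-constant * (I * (M * (prodF n leaf * (prodF n (λ v → y v ^ deg′ v) * prodF n (λ v → y v ^ deg′ v)))))
          ≡⟨ cong (λ s → total-constant * (I * (M * s))) (trans (cong (prodF n leaf *_) (sym (prodF-* n _ _))) (sym (prodF-* n _ _))) ⟩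
        total-constant * (I * (M * prodF n (λ v → leaf v * (y v ^ deg′ v * y v ^ deg′ v))))
          ≡⟨ cong (λ s → total-constant * (I * (M * s))) (trans
               (prodF-cong n (λ v → vertex-product (e w v) (deg v) (deg′ v) (lam v) (deg-nbr v) (deg≤N v)))
               (prodF-* n (λ v → e w v ⇒¹ centreFactor v) (λ v → e w v ⇒¹ centreFactor v))) ⟩
        total-constant * (I * (M * (prodF n (λ v → e w v ⇒¹ centreFactor v) * prodF n (λ v → e w v ⇒¹ centreFactor v))))
          ≡⟨ cong (λ s → total-constant * (I * (M * (s * prodF n (λ v → e w v ⇒¹ centreFactor v)))))
               (prodF-cong n (λ v → cong (e w v ⇒¹_) (edgeFactor-sym (deg v) (lam v) Δ (lam w)))) ⟩
        total-constant * (I * (M * (prodF n (λ v → e w v ⇒¹ target w v) * prodF n (λ u → e w u ⇒¹ target u w))))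
          ≡⟨ cong (λ s → total-constant * (I * s)) (prodF-edges target) ⟨
        total-constant * bound e lam ∎
        where
        open ≡-Reasoning
        iso leaf y : Fin n → ℕ
        iso v = isolatedFactor (deg v) (mass (lam v))
        leaf v = e w v ⇒¹ leafFactor (deg′ v) (centre (deg v) (lam v) ^ (2 * edgeExp (deg v) Δ))
        y v = e w v ⇒¹ linkFactor v
        I = prodF n iso
        M = prodF n (λ u → prodF n (λ v → removed u v ⇒¹ target u v))
        s₁ : ∀ i l c m p → i * l * (c * m * (p * p)) ≡ c * (i * (m * (l * (p * p))))
        s₁ = solve-∀

      cost-total : Cost (vertexExp * Δ) (λ z → total-constant * bound removed (residual z)) (total-constant * bound e lam)
      cost-total = cost-resp-≡ total-exponent (cost-weaken
        (λ z → ≤-reflexive (regroup z))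
        (≤-reflexive total-product)
        (cost-* (cost-prodF n cost-vertex) (cost-prodF n (λ u → cost-prodF n (cost-edges u)))))
        where
        s₁ : ∀ c i m → c * (i * m) ≡ i * (c * m)
        s₁ = solve-∀
        regroup : ∀ z → total-constant * bound removed (residual z) ≡
          prodF n (λ v → isolatedFactor (deg′ v) (mass (residual z v)))
            * prodF n (λ u → prodF n (λ v → pairConst u v * removed u v ⇒¹ edgeFactor (deg′ u) (residual z u) (deg′ v) (residual z v)))
        regroup z = trans (s₁ total-constant (prodF n (λ v → isolatedFactor (deg′ v) (mass (residual z v)))) _) (cong (prodF n (λ v → isolatedFactor (deg′ v) (mass (residual z v))) *_)
          (sym (trans (prodF-cong n (λ u → prodF-* n _ _)) (prodF-* n _ _))))

    -- The point mass at `w` forces `φ w` to be `z`, and the edges at `w` become the restrictions of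
    -- its neighbours' weights.
    hom-split : hom e lam ≡ mass (λ z → lam w z * hom removed (residual z))
    hom-split = sym (begin
      mass (λ z → lam w z * hom removed (residual z))
        ≡⟨ ∑-cong (allFin q) (λ z → sym (∑-*ˡ (allMaps n q) (lam w z) _)) ⟩
      mass (λ z → ∑ (allMaps n q) (λ φ → lam w z * (prodF n (λ v → residual z v (φ v)) * edges′ φ)))
        ≡⟨ ∑-swap (allFin q) (allMaps n q) _ ⟩
      ∑ (allMaps n q) (λ φ → mass (λ z → lam w z * (prodF n (λ v → residual z v (φ v)) * edges′ φ)))
        ≡⟨ ∑-cong (allMaps n q) (λ φ → trans (∑-cong (allFin q) (λ z → at-colour φ z (z ≟ φ w)))
             (trans (∑-allFin q _) (sumF-select q (φ w) _))) ⟩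
      hom e lam ∎)
      where
      open ≡-Reasoning
      edges′ : (Fin n → Fin q) → ℕ
      edges′ φ = prodF n (λ u → prodF n (λ v → removed u v ⇒¹ r (φ u) (φ v)))
      star : (Fin n → Fin q) → ℕ
      star φ = prodF n (λ v → e w v ⇒¹ r (φ w) (φ v))
      -- The edges at `w` occur twice among the ordered pairs but only once in the restricted
      -- weights; a 0-1 product is its own square.
      star-idem : ∀ φ → star φ * star φ ≡ star φ
      star-idem φ = trans (sym (prodF-* n _ _)) (prodF-cong n (λ v → idem (e w v) (r-01 (φ w) (φ v))))
        where
        idem : ∀ b {x} → x ≡ 0 ⊎ x ≡ 1 → b ⇒¹ x * b ⇒¹ x ≡ b ⇒¹ x
        idem false _           = refl
        idem true  (inj₁ refl) = refl
        idem true  (inj₂ refl) = refl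
      edges-split : ∀ φ → prodF n (λ u → prodF n (λ v → e u v ⇒¹ r (φ u) (φ v))) ≡ edges′ φ * star φ
      edges-split φ = trans (prodF-edges (λ u v → r (φ u) (φ v))) (cong (edges′ φ *_) (trans
        (cong (star φ *_) (prodF-cong n (λ u → cong (e w u ⇒¹_) (r-sym (φ u) (φ w))))) (star-idem φ)))
      weights : ∀ φ → lam w (φ w) * prodF n (λ v → residual (φ w) v (φ v)) ≡ prodF n (λ v → lam v (φ v)) * star φ
      weights φ = trans (cong (_* prodF n (λ v → residual (φ w) v (φ v))) (sym (prodF-select n w (λ _ → lam w (φ w)))))
        (trans (sym (prodF-* n _ _)) (trans (prodF-cong n (λ v → at-vertex v)) (prodF-* n _ _)))
        where
        at-vertex : ∀ v → ⌊ v ≟ w ⌋ ⇒¹ lam w (φ w) * residual (φ w) v (φ v) ≡ lam v (φ v) * e w v ⇒¹ r (φ w) (φ v)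
        at-vertex v with v ≟ w
        ... | yes refl rewrite e-irrefl w = cong (lam w (φ w) *_) (point-self (φ w))
          where
          point-self : ∀ c → point c c ≡ 1
          point-self c with c ≟ c
          ... | yes _  = refl
          ... | no c≢c = ⊥-elim (c≢c refl)
        ... | no _ with e w v
        ...   | true  = *-identityˡ _
        ...   | false = trans (*-identityˡ _) (sym (*-identityʳ _))
      e₁ : ∀ a b c d → a * b * (c * d) ≡ a * d * (b * c)
      e₁ = solve-∀
      at-colour : ∀ φ z → (d : Dec (z ≡ φ w)) → lam w z * (prodF n (λ v → residual z v (φ v)) * edges′ φ)
        ≡ ⌊ d ⌋ ⇒⁰ (prodF n (λ v → lam v (φ v)) * prodF n (λ u → prodF n (λ v → e u v ⇒¹ r (φ u) (φ v))))
      at-colour φ z (yes refl) = begin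
        lam w z * (prodF n (λ v → residual z v (φ v)) * edges′ φ) ≡⟨ *-assoc (lam w z) _ _ ⟨
        lam w z * prodF n (λ v → residual z v (φ v)) * edges′ φ   ≡⟨ cong (_* edges′ φ) (weights φ) ⟩
        prodF n (λ v → lam v (φ v)) * star φ * edges′ φ           ≡⟨ *-assoc (prodF n (λ v → lam v (φ v))) _ _ ⟩
        prodF n (λ v → lam v (φ v)) * (star φ * edges′ φ)         ≡⟨ cong (prodF n (λ v → lam v (φ v)) *_) (trans (*-comm (star φ) _) (sym (edges-split φ))) ⟩
        prodF n (λ v → lam v (φ v)) * prodF n (λ u → prodF n (λ v → e u v ⇒¹ r (φ u) (φ v))) ∎
      at-colour φ z (no z≢φw) = trans (cong (λ s → lam w z * (s * edges′ φ)) (prodF-zero n _ w vanishes)) (*-zeroʳ (lam w z))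
        where
        vanishes : residual z w (φ w) ≡ 0
        vanishes rewrite residual-w z with φ w ≟ z
        ... | yes eq = ⊥-elim (z≢φw (sym eq))
        ... | no _   = refl

    step : (∀ z → hom removed (residual z) ^ vertexExp ≤ bound removed (residual z)) →
      hom e lam ^ vertexExp ≤ bound e lam
    step ih with prodF n (λ v → mass (lam v)) in eq
    -- If some vertex has mass 0, `total-constant` may be 0 and resist cancellation, but then `hom`
    -- is 0 as well.
    ... | zero = ≤-trans (≤-reflexive (cong (_^ vertexExp) hom≡0)) (≤-trans (≤-reflexive (0^ vertexExp>0)) z≤n)
      where
      hom≡0 : hom e lam ≡ 0
      hom≡0 = n≤0⇒n≡0 (≤-trans (hom≤masses e lam) (≤-reflexive eq))
      0^ : ∀ {k} → 0 < k → 0 ^ k ≡ 0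
      0^ (s≤s _) = refl
    -- Applied with the residual count as `Q` and `κ = vertexExp`, for which `cost-total` has just
    -- the exponent `κ * Δ`.
    ... | suc _ = *-cancelˡ-≤′ total-constant constant>0
      (subst (λ h → total-constant * h ^ vertexExp ≤ total-constant * bound e lam) (sym hom-split)
        (root-approximation q (lam w) (λ z → hom removed (residual z)) Δ vertexExp total-constant _ deg>0
          λ D μ μ≤ → let open Certificates μ in
            Costs.cost-bound q (lam w) μ Δ total-constant (λ z → hom removed (residual z)) D vertexExp>0 deg>0
              (λ z → *-monoʳ-≤ total-constant (ih z)) μ≤ cost-total))
      where
      mass>0 : ∀ v → 0 < mass (lam v)
      mass>0 v = zero-or-positive (mass (lam v)) λ m≡0 → ⊥-elim (0≢1+n (trans (sym (prodF-zero n _ v m≡0)) eq))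
      ⇒¹>0 : ∀ b {x} → 0 < x → 0 < b ⇒¹ x
      ⇒¹>0 true  x>0 = x>0
      ⇒¹>0 false x>0 = s≤s z≤n
      constant>0 : 0 < total-constant
      constant>0 = prodF-positive n _ (λ u → prodF-positive n _ (λ v →
        ⇒¹>0 (removed u v) (⇒¹>0 (e w u) (⇒¹>0 (e w v) (^-positive (massExp (deg v)) (mass>0 v))))))

  edgeless-bound : ∀ {n} e (lam : Fin n → Weight) → (∀ v → count n (e v) ≡ 0) → hom e lam ^ vertexExp ≤ bound e lam
  edgeless-bound {n} e lam deg≡0 = begin
    hom e lam ^ vertexExp                                   ≤⟨ ^-monoˡ-≤ vertexExp (hom≤masses e lam) ⟩
    prodF n (λ v → mass (lam v)) ^ vertexExp                ≡⟨ prodF-^ n _ vertexExp ⟨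
    prodF n (λ v → mass (lam v) ^ vertexExp)                ≡⟨ prodF-cong n (λ v → cong (λ d → isolatedFactor d (mass (lam v))) (sym (deg≡0 v))) ⟩
    prodF n (λ v → isolatedFactor (count n (e v)) (mass (lam v))) ≡⟨ *-identityʳ _ ⟨
    prodF n (λ v → isolatedFactor (count n (e v)) (mass (lam v))) * 1 ≡⟨ cong (prodF n (λ v → isolatedFactor (count n (e v)) (mass (lam v))) *_)
      (trans (prodF-cong n (λ u → trans (prodF-cong n (λ v → no-edge u v)) (prodF-one n))) (prodF-one n)) ⟨
    bound e lam ∎
    where
    open ≤-Reasoning
    no-edge : ∀ u v → e u v ⇒¹ edgeFactor (count n (e u)) (lam u) (count n (e v)) (lam v) ≡ 1
    no-edge u v with e u v in eq
    ... | false = refl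
    ... | true  = ⊥-elim (<⇒≱ (s≤s z≤n) (≤-trans (≤-reflexive (sym (cong (_⇒⁰ 1) eq)))
                    (≤-trans (sumF-≥ n (λ x → e u x ⇒⁰ 1) v) (≤-reflexive (deg≡0 u)))))

  -- The induction is on the total degree, bounded by `fuel`, because isolating `w` leaves the
  -- number of vertices unchanged.
  hom-bound : ∀ fuel {n} e → (∀ u v → e u v ≡ e v u) → (∀ v → e v v ≡ false) → (lam : Fin n → Weight) →
    (∀ v → count n (e v) ≤ N) → sumF n (λ v → count n (e v)) ≤ fuel → hom e lam ^ vertexExp ≤ bound e lam
  hom-bound fuel {zero}  e e-sym e-irrefl lam deg≤N size = edgeless-bound e lam λ ()
  hom-bound fuel {suc n} e e-sym e-irrefl lam deg≤N size with argmax n (λ v → count (suc n) (e v))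
  ... | w , deg-max with count (suc n) (e w) in eq
  ...   | zero  = edgeless-bound e lam (λ v → n≤0⇒n≡0 (deg-max v))
  hom-bound zero {suc n} e e-sym e-irrefl lam deg≤N size | w , deg-max | suc d =
    ⊥-elim (0≢1+n (sym (trans (sym eq) (n≤0⇒n≡0 (≤-trans (sumF-≥ (suc n) (λ v → count (suc n) (e v)) w) size)))))
  hom-bound (suc fuel) {suc n} e e-sym e-irrefl lam deg≤N size | w , deg-max | suc d =
    step λ z → hom-bound fuel (At.removed w) (At.removed-sym w) (At.removed-irrefl w) (residual z)
        (λ v → ≤-trans (At.deg′≤deg w v) (deg≤N v))
        (≤-pred (≤-trans (At.total-degree-decreases w deg>0) size))
    where
    open Removal e e-sym e-irrefl
    deg>0 : 0 < count (suc n) (e w)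
    deg>0 = ≤-trans (s≤s z≤n) (≤-reflexive (sym eq))
    open VertexStep e e-sym e-irrefl lam w deg≤N (λ v → ≤-trans (deg-max v) (≤-reflexive (sym eq))) deg>0

-- Semiproper colourings

kernel : ∀ q ℓ → Fin q → Fin q → ℕ
kernel q ℓ x y = KEdge q ℓ x y ⇒⁰ 1

kernel-sym : ∀ q ℓ x y → kernel q ℓ x y ≡ kernel q ℓ y x
kernel-sym q ℓ x y with x ≟ y | y ≟ x
... | yes refl | yes _  = refl
... | yes x≡y  | no y≢x = ⊥-elim (y≢x (sym x≡y))
... | no x≢y   | yes y≡x = ⊥-elim (x≢y (sym y≡x))
... | no _     | no _   = refl

kernel-01 : ∀ q ℓ x y → kernel q ℓ x y ≡ 0 ⊎ kernel q ℓ x y ≡ 1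
kernel-01 q ℓ x y with KEdge q ℓ x y
... | false = inj₁ refl
... | true  = inj₂ refl

-- Distinct colours are always compatible, and `x` cannot equal `y` since `z` treats them
-- differently.
kernel-compat : ∀ q ℓ z x y → kernel q ℓ z x ≡ 1 → kernel q ℓ z y ≡ 0 → kernel q ℓ x y ≡ 1
kernel-compat q ℓ z x y zx zy with x ≟ y
... | no _ = refl
... | yes refl with trans (sym zx) zy
...   | ()

length-filter : ∀ {A : Set} (b : A → Bool) xs → length (filter (λ x → b x Bool.≟ true) xs) ≡ ∑ xs (λ x → b x ⇒⁰ 1)
length-filter b []       = refl
length-filter b (x ∷ xs) with b x
... | true  = cong suc (length-filter b xs)
... | false = length-filter b xs

allB-prodF : ∀ {k} (p : Fin k → Bool) → allB p ⇒⁰ 1 ≡ prodF k (λ i → p i ⇒⁰ 1)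
allB-prodF {k} p = go k (λ i → i)
  where
  ∧-* : ∀ a b → (a ∧ b) ⇒⁰ 1 ≡ a ⇒⁰ 1 * b ⇒⁰ 1
  ∧-* true  b = sym (*-identityˡ _)
  ∧-* false b = refl
  go : ∀ m (g : Fin m → Fin k) → foldr _∧_ true (map p (tabulate g)) ⇒⁰ 1 ≡ prodF m (λ i → p (g i) ⇒⁰ 1)
  go zero    g = refl
  go (suc m) g = trans (∧-* (p (g zero)) _) (cong (p (g zero) ⇒⁰ 1 *_) (go m (λ i → g (suc i))))

IsHomB-prodF : ∀ G q ℓ φ → IsHomB G q ℓ φ ⇒⁰ 1 ≡
  prodF (SimpleGraph.n G) (λ u → prodF (SimpleGraph.n G) (λ v → adj G u v ⇒¹ kernel q ℓ (φ u) (φ v)))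
IsHomB-prodF G q ℓ φ = trans (allB-prodF (λ u → allB (hom-at u))) (prodF-cong n (λ u →
  trans (allB-prodF (hom-at u)) (prodF-cong n (λ v → implication (adj G u v) (KEdge q ℓ (φ u) (φ v))))))
  where
  n = SimpleGraph.n G
  hom-at : Fin n → Fin n → Bool
  hom-at u v = not (adj G u v) ∨ KEdge q ℓ (φ u) (φ v)
  implication : ∀ a b → (not a ∨ b) ⇒⁰ 1 ≡ a ⇒¹ b ⇒⁰ 1
  implication true  b = refl
  implication false b = refl

homK-∑ : ∀ G q ℓ → homK G q ℓ ≡ ∑ (allMaps (SimpleGraph.n G) q) (λ φ →
  prodF (SimpleGraph.n G) (λ u → prodF (SimpleGraph.n G) (λ v → adj G u v ⇒¹ kernel q ℓ (φ u) (φ v))))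
homK-∑ G q ℓ = trans (length-filter (IsHomB G q ℓ) (allMaps (SimpleGraph.n G) q)) (∑-cong (allMaps (SimpleGraph.n G) q) (IsHomB-prodF G q ℓ))

-- Colourings of complete bipartite graphs

prodF-+ : ∀ a b (f : Fin (a + b) → ℕ) → prodF (a + b) f ≡ prodF a (λ i → f (i ↑ˡ b)) * prodF b (λ j → f (a ↑ʳ j))
prodF-+ zero    b f = sym (*-identityˡ _)
prodF-+ (suc a) b f = trans (cong (f zero *_) (prodF-+ a b (λ i → f (suc i)))) (sym (*-assoc (f zero) _ _))

join : ∀ {A : Set} a {b} → (Fin a → A) → (Fin b → A) → Fin (a + b) → A
join zero    x y = y
join (suc a) x y = x zero ∷ᶠ join a (λ i → x (suc i)) y

join-↑ˡ : ∀ {A : Set} a {b} (x : Fin a → A) (y : Fin b → A) i → join a x y (i ↑ˡ b) ≡ x i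
join-↑ˡ (suc a) x y zero    = refl
join-↑ˡ (suc a) x y (suc i) = join-↑ˡ a (λ i → x (suc i)) y i

join-↑ʳ : ∀ {A : Set} a {b} (x : Fin a → A) (y : Fin b → A) j → join a x y (a ↑ʳ j) ≡ y j
join-↑ʳ zero    x y j = refl
join-↑ʳ (suc a) x y j = join-↑ʳ a (λ i → x (suc i)) y j

∑-allMaps-+ : ∀ a b q (f : (Fin (a + b) → Fin q) → ℕ) →
  ∑ (allMaps (a + b) q) f ≡ ∑ (allMaps a q) (λ x → ∑ (allMaps b q) (λ y → f (join a x y)))
∑-allMaps-+ zero    b q f = sym (+-identityʳ _)
∑-allMaps-+ (suc a) b q f = trans (∑-allMaps-suc (a + b) q f)
  (trans (∑-cong (allFin q) (λ c → ∑-allMaps-+ a b q (λ φ → f (c ∷ᶠ φ))))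
         (sym (∑-allMaps-suc a q _)))

↑ˡ-<ᵇ : ∀ {a} b (i : Fin a) → (toℕ (i ↑ˡ b) <ᵇ a) ≡ true
↑ˡ-<ᵇ b zero    = refl
↑ˡ-<ᵇ b (suc i) = ↑ˡ-<ᵇ b i

↑ʳ-<ᵇ : ∀ a {b} (j : Fin b) → (toℕ (a ↑ʳ j) <ᵇ a) ≡ false
↑ʳ-<ᵇ zero    j = refl
↑ʳ-<ᵇ (suc a) j = ↑ʳ-<ᵇ a j

module _ (q ℓ : ℕ) where
  open Kernel q (kernel q ℓ) (kernel-sym q ℓ)

  one : Weight
  one _ = 1

  -- A colouring is a pair of tuples. Pairs within a part impose nothing, and each cross pair
  -- appears in both orientations, which the 0-1 kernel absorbs.
  homK-Kbip : ∀ a b → homK (Kbip a b) q ℓ ≡ bip a one b one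
  homK-Kbip a b = begin
    homK (Kbip a b) q ℓ
      ≡⟨ homK-∑ (Kbip a b) q ℓ ⟩
    ∑ (allMaps (a + b) q) edges′
      ≡⟨ ∑-allMaps-+ a b q edges′ ⟩
    ∑ (allMaps a q) (λ x → ∑ (allMaps b q) (λ y → edges′ (join a x y)))
      ≡⟨ ∑-cong (allMaps a q) (λ x → ∑-cong (allMaps b q) (λ y → trans (edges-join x y)
           (prodF-cong b (λ j → sym (*-identityˡ _))))) ⟩
    ∑ (allMaps a q) (λ x → ∑ (allMaps b q) (λ y → prodF b (λ j → 1 * prodF a (λ i → r (x i) (y j)))))
      ≡⟨ ∑-cong (allMaps a q) (λ x → trans (sym (∑-^ b q (λ y → 1 * prodF a (λ i → r (x i) y))))
           (sym (trans (cong (_* nbr a x one ^ b) (prodF-one a)) (*-identityˡ _)))) ⟩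
    bip a one b one ∎
    where
    open ≡-Reasoning
    r : Fin q → Fin q → ℕ
    r = kernel q ℓ
    A : Fin (a + b) → Fin (a + b) → Bool
    A = adj (Kbip a b)
    edges′ : (Fin (a + b) → Fin q) → ℕ
    edges′ φ = prodF (a + b) (λ u → prodF (a + b) (λ v → A u v ⇒¹ r (φ u) (φ v)))
    idem : ∀ x y → r x y * r x y ≡ r x y
    idem x y with kernel-01 q ℓ x y
    ... | inj₁ eq rewrite eq = refl
    ... | inj₂ eq rewrite eq = refl
    edges-join : ∀ x y → edges′ (join a x y) ≡ prodF b (λ j → prodF a (λ i → r (x i) (y j)))
    edges-join x y = begin
      edges′ φ
        ≡⟨ prodF-+ a b _ ⟩
      prodF a (λ i → prodF (a + b) (λ v → A (i ↑ˡ b) v ⇒¹ r (φ (i ↑ˡ b)) (φ v)))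
        * prodF b (λ j → prodF (a + b) (λ v → A (a ↑ʳ j) v ⇒¹ r (φ (a ↑ʳ j)) (φ v)))
        ≡⟨ cong₂ _*_ (prodF-cong a (λ i → trans (prodF-+ a b _) (trans (cong₂ _*_ (trans (prodF-cong a (ll i)) (prodF-one a)) (prodF-cong b (lr i))) (*-identityˡ _))))
                     (prodF-cong b (λ j → trans (prodF-+ a b _) (trans (cong₂ _*_ (prodF-cong a (rl j)) (trans (prodF-cong b (rr j)) (prodF-one b))) (*-identityʳ _)))) ⟩
      prodF a (λ i → prodF b (λ j → r (x i) (y j))) * prodF b (λ j → prodF a (λ i → r (x i) (y j)))
        ≡⟨ cong (_* prodF b (λ j → prodF a (λ i → r (x i) (y j)))) (prodF-swap a b (λ i j → r (x i) (y j))) ⟩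
      prodF b (λ j → prodF a (λ i → r (x i) (y j))) * prodF b (λ j → prodF a (λ i → r (x i) (y j)))
        ≡⟨ prodF-* b _ _ ⟨
      prodF b (λ j → prodF a (λ i → r (x i) (y j)) * prodF a (λ i → r (x i) (y j)))
        ≡⟨ prodF-cong b (λ j → trans (sym (prodF-* a _ _)) (prodF-cong a (λ i → idem (x i) (y j)))) ⟩
      prodF b (λ j → prodF a (λ i → r (x i) (y j))) ∎
      where
      φ : Fin (a + b) → Fin q
      φ = join a x y
      ll : ∀ i i′ → A (i ↑ˡ b) (i′ ↑ˡ b) ⇒¹ r (φ (i ↑ˡ b)) (φ (i′ ↑ˡ b)) ≡ 1
      ll i i′ rewrite ↑ˡ-<ᵇ b i | ↑ˡ-<ᵇ b i′ = refl
      lr : ∀ i j → A (i ↑ˡ b) (a ↑ʳ j) ⇒¹ r (φ (i ↑ˡ b)) (φ (a ↑ʳ j)) ≡ r (x i) (y j)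
      lr i j rewrite ↑ˡ-<ᵇ b i | ↑ʳ-<ᵇ a j | join-↑ˡ a x y i | join-↑ʳ a x y j = refl
      rl : ∀ j i → A (a ↑ʳ j) (i ↑ˡ b) ⇒¹ r (φ (a ↑ʳ j)) (φ (i ↑ˡ b)) ≡ r (x i) (y j)
      rl j i rewrite ↑ˡ-<ᵇ b i | ↑ʳ-<ᵇ a j | join-↑ˡ a x y i | join-↑ʳ a x y j = kernel-sym q ℓ (y j) (x i)
      rr : ∀ j j′ → A (a ↑ʳ j) (a ↑ʳ j′) ⇒¹ r (φ (a ↑ʳ j)) (φ (a ↑ʳ j′)) ≡ 1
      rr j j′ rewrite ↑ʳ-<ᵇ a j | ↑ʳ-<ᵇ a j′ = refl

-- Products over the list of edges

prodL : ∀ {A : Set} → List A → (A → ℕ) → ℕ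
prodL xs f = prodF (length xs) (λ i → f (lookup xs i))

prodL-++ : ∀ {A : Set} (xs ys : List A) f → prodL (xs ++ ys) f ≡ prodL xs f * prodL ys f
prodL-++ []       ys f = sym (*-identityˡ _)
prodL-++ (x ∷ xs) ys f = trans (cong (f x *_) (prodL-++ xs ys f)) (sym (*-assoc (f x) _ _))

prodL-filter : ∀ {A : Set} (b : A → Bool) xs f →
  prodL (filter (λ x → b x Bool.≟ true) xs) f ≡ prodL xs (λ x → b x ⇒¹ f x)
prodL-filter b []       f = refl
prodL-filter b (x ∷ xs) f with b x
... | true  = cong (f x *_) (prodL-filter b xs f)
... | false = trans (prodL-filter b xs f) (sym (*-identityˡ _))

prodL-tabulate : ∀ {A : Set} k (g : Fin k → A) f → prodL (tabulate g) f ≡ prodF k (λ i → f (g i))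
prodL-tabulate zero    g f = refl
prodL-tabulate (suc k) g f = cong (f (g zero) *_) (prodL-tabulate k (λ i → g (suc i)) f)

prodL-map : ∀ {A B : Set} (g : A → B) xs f → prodL (map g xs) f ≡ prodL xs (λ x → f (g x))
prodL-map g []       f = refl
prodL-map g (x ∷ xs) f = cong (f (g x) *_) (prodL-map g xs f)

prodL-concatMap : ∀ {A B : Set} (g : A → List B) xs f → prodL (concatMap g xs) f ≡ prodL xs (λ x → prodL (g x) f)
prodL-concatMap g []       f = refl
prodL-concatMap g (x ∷ xs) f = trans (prodL-++ (g x) _ f) (cong (prodL (g x) f *_) (prodL-concatMap g xs f))

-- The list has each edge once, with its smaller end first, so a symmetric factor occurs twice as
-- often among the ordered pairs.
prodF-ordered-pairs : ∀ (G : SimpleGraph) (g : Fin (SimpleGraph.n G) → Fin (SimpleGraph.n G) → ℕ) →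
  (∀ u v → g u v ≡ g v u) →
  prodF (SimpleGraph.n G) (λ u → prodF (SimpleGraph.n G) (λ v → adj G u v ⇒¹ g u v))
    ≡ prodL (edges G) (λ p → g (proj₁ p) (proj₂ p)) ^ 2
prodF-ordered-pairs G g g-sym = begin
  prodF n (λ u → prodF n (λ v → adj G u v ⇒¹ g u v))
    ≡⟨ prodF-cong n (λ u → prodF-cong n (λ v → by-order u v)) ⟩
  prodF n (λ u → prodF n (λ v → upper u v * upper v u))
    ≡⟨ trans (prodF-cong n (λ u → prodF-* n _ _)) (prodF-* n _ _) ⟩
  U * prodF n (λ u → prodF n (λ v → upper v u))
    ≡⟨ cong (U *_) (prodF-swap n n _) ⟩
  U * U
    ≡⟨ cong (λ s → s * s) list ⟨
  L * L
    ≡⟨ cong (L *_) (*-identityʳ L) ⟨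
  L ^ 2 ∎
  where
  open ≡-Reasoning
  n = SimpleGraph.n G
  L = prodL (edges G) (λ p → g (proj₁ p) (proj₂ p))
  upper : Fin n → Fin n → ℕ
  upper u v = ((toℕ u <ᵇ toℕ v) ∧ adj G u v) ⇒¹ g u v
  U = prodF n (λ u → prodF n (λ v → upper u v))
  list : L ≡ U
  list = trans (prodL-filter ordered (concatMap pairs (allFin n)) value)
    (trans (prodL-concatMap pairs (allFin n) (λ p → ordered p ⇒¹ value p))
      (trans (prodL-tabulate n (λ u → u) (λ u → prodL (pairs u) (λ p → ordered p ⇒¹ value p)))
        (prodF-cong n (λ u → trans (prodL-map (u ,_) (allFin n) (λ p → ordered p ⇒¹ value p))
          (prodL-tabulate n (λ v → v) (upper u))))))
    where
    pairs : Fin n → List (Fin n × Fin n)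
    pairs u = map (λ v → (u , v)) (allFin n)
    ordered : Fin n × Fin n → Bool
    ordered p = (toℕ (proj₁ p) <ᵇ toℕ (proj₂ p)) ∧ adj G (proj₁ p) (proj₂ p)
    value : Fin n × Fin n → ℕ
    value p = g (proj₁ p) (proj₂ p)
  <ᵇ-irrefl : ∀ m → (m <ᵇ m) ≡ false
  <ᵇ-irrefl zero    = refl
  <ᵇ-irrefl (suc m) = <ᵇ-irrefl m
  <ᵇ-tri : ∀ k l → k ≢ l → (l <ᵇ k) ≡ not (k <ᵇ l)
  <ᵇ-tri zero    zero    k≢l = ⊥-elim (k≢l refl)
  <ᵇ-tri zero    (suc l) k≢l = refl
  <ᵇ-tri (suc k) zero    k≢l = refl
  <ᵇ-tri (suc k) (suc l) k≢l = <ᵇ-tri k l (λ k≡l → k≢l (cong suc k≡l))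
  by-order : ∀ u v → adj G u v ⇒¹ g u v ≡ upper u v * upper v u
  by-order u v with u ≟ v
  ... | yes refl rewrite SimpleGraph.irrefl G u | <ᵇ-irrefl (toℕ u) = refl
  ... | no u≢v rewrite SimpleGraph.sym G v u | g-sym v u | <ᵇ-tri (toℕ u) (toℕ v) (λ eq → u≢v (toℕ-injective eq))
    with toℕ u <ᵇ toℕ v | adj G u v
  ...   | true  | true  = sym (*-identityʳ _)
  ...   | true  | false = refl
  ...   | false | true  = sym (*-identityˡ _)
  ...   | false | false = refl

-- Clearing the denominators

-- The construction gives `K = N!`, and `inv a` is the exact quotient `K / a` for `a` from 1 to `N`.
common-multiple : ∀ N → ∃₂ λ K (inv : ℕ → ℕ) → 0 < K × (∀ a → 0 < a → a ≤ N → a * inv a ≡ K)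
common-multiple zero    = 1 , (λ _ → 0) , s≤s z≤n , λ { a (s≤s _) () }
common-multiple (suc N) with common-multiple N
... | K , inv , K>0 , inv-* = suc N * K , inv′ , *-mono-≤ (s≤s (z≤n {N})) K>0 , inv′-*
  where
  inv′ : ℕ → ℕ
  inv′ a = if ⌊ a ℕ.≟ suc N ⌋ then K else suc N * inv a
  e : ∀ a b c → a * (b * c) ≡ b * (a * c)
  e = solve-∀
  inv′-* : ∀ a → 0 < a → a ≤ suc N → a * inv′ a ≡ suc N * K
  inv′-* a a>0 a≤1+N with a ℕ.≟ suc N
  ... | yes refl = refl
  ... | no a≢1+N = trans (e a (suc N) (inv a)) (cong (suc N *_) (inv-* a a>0 (≤-pred (≤∧≢⇒< a≤1+N a≢1+N))))

exponentAt-* : ∀ G e → exponentAt G e * edgeWeight G e ≡ commonExp G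
exponentAt-* G e = trans (cong (exponentAt G e *_) (sym (prodF-select (numEdges G) e (edgeWeight G))))
  (trans (sym (prodF-* (numEdges G) _ _)) (prodF-cong (numEdges G) (λ f → combine ⌊ f ≟ e ⌋ (edgeWeight G f))))
  where
  combine : ∀ b m → (if b then 1 else m) * b ⇒¹ m ≡ m
  combine true  m = *-identityˡ m
  combine false m = *-identityʳ m

theorem1p7 : (G : SimpleGraph) → NoIsolated G → (q ℓ : ℕ) → ℓ ≤ q →
    homK G q ℓ ^ commonExp G
    ≤ prodF (numEdges G) (λ e → edgeBase G q ℓ e ^ exponentAt G e)
theorem1p7 G no-isolated q ℓ ℓ≤q with common-multiple (SimpleGraph.n G)
-- The induction clears denominators with `K⁴`, the statement with `commonExp G`; raising to both
-- powers makes the two comparable.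
... | K , inv , K>0 , inv-* = ^-cancelˡ-≤ K⁴ K⁴>0 (begin
    (H ^ P) ^ K⁴                                        ≡⟨ trans (^-*-assoc H P K⁴) (trans (cong (H ^_) (*-comm P K⁴)) (sym (^-*-assoc H K⁴ P))) ⟩
    (H ^ K⁴) ^ P                                        ≤⟨ ^-monoˡ-≤ P H≤L ⟩
    L ^ P                                               ≡⟨ prodF-^ (numEdges G) _ P ⟨
    prodF (numEdges G) (λ e → (edgeBase G q ℓ e ^ edgeExpAt e) ^ P)
                                                        ≡⟨ prodF-cong (numEdges G) rescale ⟩
    prodF (numEdges G) (λ e → (edgeBase G q ℓ e ^ exponentAt G e) ^ K⁴)
                                                        ≡⟨ prodF-^ (numEdges G) _ K⁴ ⟩
    prodF (numEdges G) (λ e → edgeBase G q ℓ e ^ exponentAt G e) ^ K⁴ ∎)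
  where
  open ≤-Reasoning
  n = SimpleGraph.n G
  open Induction q (kernel q ℓ) (kernel-sym q ℓ) (kernel-01 q ℓ) (kernel-compat q ℓ) n K K>0 inv inv-*
  H = homK G q ℓ
  P = commonExp G
  K⁴ = K * K * (K * K)
  K⁴>0 : 0 < K⁴
  K⁴>0 = *-mono-≤ (*-mono-≤ K>0 K>0) (*-mono-≤ K>0 K>0)
  base : Fin n → Fin n → ℕ
  base u v = homK (Kbip (degree G u) (degree G v)) q ℓ
  g : Fin n → Fin n → ℕ
  g u v = base u v ^ edgeExp (degree G u) (degree G v)
  L = prodL (edges G) (λ p → g (proj₁ p) (proj₂ p))
  edgeExpAt : Fin (numEdges G) → ℕ
  edgeExpAt e = edgeExp (degree G (proj₁ (edgeAt G e))) (degree G (proj₂ (edgeAt G e)))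

  edgeFactor-base : ∀ u v → edgeFactor (degree G u) (one q ℓ) (degree G v) (one q ℓ) ≡ g u v
  edgeFactor-base u v = cong (_^ edgeExp (degree G u) (degree G v))
    (trans (bip-sym (degree G v) (one q ℓ) (degree G u) (one q ℓ)) (sym (homK-Kbip q ℓ (degree G u) (degree G v))))

  g-sym : ∀ u v → g u v ≡ g v u
  g-sym u v = trans (sym (edgeFactor-base u v))
    (trans (edgeFactor-sym (degree G u) (one q ℓ) (degree G v) (one q ℓ)) (edgeFactor-base v u))

  H-hom : H ≡ hom (adj G) (λ _ → one q ℓ)
  H-hom = trans (homK-∑ G q ℓ) (∑-cong (allMaps n q) (λ φ →
    sym (trans (cong (_* prodF n (λ u → prodF n (λ v → adj G u v ⇒¹ kernel q ℓ (φ u) (φ v)))) (prodF-one n)) (*-identityˡ _))))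

  bound-L : bound (adj G) (λ _ → one q ℓ) ≡ L ^ 2
  bound-L = trans (cong₂ _*_
      (trans (prodF-cong n (λ v → not-isolated (no-isolated v))) (prodF-one n))
      (trans (prodF-cong n (λ u → prodF-cong n (λ v → cong (adj G u v ⇒¹_) (edgeFactor-base u v)))) (prodF-ordered-pairs G g g-sym)))
    (*-identityˡ _)
    where
    not-isolated : ∀ {d m} → 0 < d → isolatedFactor d m ≡ 1
    not-isolated (s≤s _) = refl

  degree≤n : ∀ v → degree G v ≤ n
  degree≤n v = ≤-trans (sumF-mono n {g = λ _ → 1} (λ u → le (adj G v u))) (≤-reflexive (trans (sumF-count n (λ _ → true) 1) (ones n)))
    where
    le : ∀ b → b ⇒⁰ 1 ≤ 1
    le true  = ≤-refl
    le false = z≤n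
    ones : ∀ k → count k (λ _ → true) * 1 ≡ k
    ones zero    = refl
    ones (suc k) = cong suc (ones k)

  -- `vertexExp` is `2 * K⁴` and `bound` is the square of `L`, so a square root removes the double
  -- count of edges.
  H≤L : H ^ K⁴ ≤ L
  H≤L = ^-cancelˡ-≤ 2 (s≤s z≤n) (begin
    (H ^ K⁴) ^ 2        ≡⟨ trans (^-*-assoc H K⁴ 2) (cong (H ^_) (*-comm K⁴ 2)) ⟩
    H ^ vertexExp       ≡⟨ cong (_^ vertexExp) H-hom ⟩
    hom (adj G) (λ _ → one q ℓ) ^ vertexExp
      ≤⟨ hom-bound _ (adj G) (SimpleGraph.sym G) (SimpleGraph.irrefl G) (λ _ → one q ℓ) degree≤n ≤-refl ⟩
    bound (adj G) (λ _ → one q ℓ) ≡⟨ bound-L ⟩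
    L ^ 2               ∎)

  rescale : ∀ e → (edgeBase G q ℓ e ^ edgeExpAt e) ^ P ≡ (edgeBase G q ℓ e ^ exponentAt G e) ^ K⁴
  rescale e = trans (^-*-assoc (edgeBase G q ℓ e) (edgeExpAt e) P)
    (trans (cong (edgeBase G q ℓ e ^_) exp-eq) (sym (^-*-assoc (edgeBase G q ℓ e) (exponentAt G e) K⁴)))
    where
    a = degree G (proj₁ (edgeAt G e))
    b = degree G (proj₂ (edgeAt G e))
    s₁ : ∀ ia ib k x a b → ia * ib * k * (x * (a * b)) ≡ x * (a * ia * (b * ib) * k)
    s₁ = solve-∀
    -- Both sides are `P * K⁴` divided by `a * b`; the degrees are positive because no vertex is
    -- isolated.
    exp-eq : edgeExpAt e * P ≡ exponentAt G e * K⁴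
    exp-eq = trans (cong (edgeExpAt e *_) (sym (exponentAt-* G e)))
      (trans (s₁ (inv a) (inv b) (K * K) (exponentAt G e) a b)
        (cong₂ (λ s t → exponentAt G e * (s * t * (K * K)))
          (inv-* a (no-isolated _) (degree≤n _)) (inv-* b (no-isolated _) (degree≤n _))))
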